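{- Let $k \geqslant 5$ be an integer. If $k$ is odd, then there is a graph which is in $B_{k}$ but not in $B_{2k-8}^{m}$. If $k$ is even, then there is a graph which is in $B_{k}$ but not in $B_{2k-9}^{m}$.
   Context: All graphs are finite and simple. A grid consists of horizontal grid lines (rows, increasing from bottom to top) and vertical grid lines (columns, increasing from left to right). A grid point is a crossing of two grid lines. A grid edge is the part of a grid line between two consecutive grid points. A path on a grid consists of two grid points (its end points) and a number of consecutive grid edges connecting them. A bend of a path is a turn of the path at a grid point. An EPG representation of a graph $G$ assigns to each vertex $v$ of $G$ a path $P_v$ on a common grid such that two distinct vertices $v,w$ are adjacent in $G$ if and only if $P_v$ and $P_w$ share at least one grid edge. A path is monotonic if it is ascending in both columns and rows, i.e. it has the shape of a staircase going upwards from left to right. For a nonnegative integer $k$, $B_k$ is the class of all graphs that have an EPG representation in which every path has at most $k$ bends. For a nonnegative integer $\ell$, $B_\ell^m$ (the superscript $m$ is just a symbol for "monotonic") is the class of all graphs that have an EPG representation in which every path is monotonic and has at most $\ell$ bends. -}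

module Defs where

open import Level using (0ℓ)
open import Data.Bool.Base using (if_then_else_)
open import Data.Fin.Base using (Fin)
open import Data.Integer.Base using (ℤ) renaming (suc to sucℤ; pred to predℤ)
open import Data.List.Base using (List; []; _∷_)
open import Data.List.Membership.Propositional using (_∈_)
open import Data.List.Relation.Unary.All using (All)
open import Data.List.Relation.Unary.Unique.Propositional using (Unique)
open import Data.Nat.Base using (ℕ; zero; suc; _≤_)
open import Data.Product.Base using (_×_; _,_; ∃-syntax)
open import Function.Bundles using (_⇔_)
open import Relation.Binary.Core using (Rel)
open import Relation.Binary.Definitions
  using (Symmetric; Irreflexive; Decidable; DecidableEquality)
open import Relation.Binary.PropositionalEquality.Core using (_≡_; refl; _≢_)
open import Relation.Nullary.Decidable.Core using (does; yes; no)

record Graph : Set₁ where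
  field
    order  : ℕ
    Adj    : Rel (Fin order) 0ℓ
    sym    : Symmetric Adj
    irrefl : Irreflexive _≡_ Adj
    adj?   : Decidable Adj

  Vertex : Set
  Vertex = Fin order

-- (column , row).  The grid lines are indexed by ℤ.  A representation involves
-- finitely many finite paths, so it only ever uses a finite part of this grid,
-- and every finite grid is a part of it.
Point : Set
Point = ℤ × ℤ

-- Undirected: horizontal p joins p to its right neighbour and vertical p joins
-- p to its upper neighbour, so each grid edge has exactly one name.
data GridEdge : Set where
  horizontal : Point → GridEdge
  vertical   : Point → GridEdge

data Direction : Set where
  right left up down : Direction

_≟_ : DecidableEquality Direction
right ≟ right = yes refl
right ≟ left  = no λ ()
right ≟ up    = no λ ()
right ≟ down  = no λ ()
left  ≟ right = no λ ()
left  ≟ left  = yes refl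
left  ≟ up    = no λ ()
left  ≟ down  = no λ ()
up    ≟ right = no λ ()
up    ≟ left  = no λ ()
up    ≟ up    = yes refl
up    ≟ down  = no λ ()
down  ≟ right = no λ ()
down  ≟ left  = no λ ()
down  ≟ up    = no λ ()
down  ≟ down  = yes refl

move : Direction → Point → Point
move right (x , y) = sucℤ x , y
move left  (x , y) = predℤ x , y
move up    (x , y) = x , sucℤ y
move down  (x , y) = x , predℤ y

edgeAt : Direction → Point → GridEdge
edgeAt right p = horizontal p
edgeAt left  p = horizontal (move left p)
edgeAt up    p = vertical p
edgeAt down  p = vertical (move down p)

walkEdges : Point → List Direction → List GridEdge
walkEdges p []       = []
walkEdges p (d ∷ ds) = edgeAt d p ∷ walkEdges (move d p) ds

walkEnd : Point → List Direction → Point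
walkEnd p []       = p
walkEnd p (d ∷ ds) = walkEnd (move d p) ds

directionChanges : List Direction → ℕ
directionChanges []           = zero
directionChanges (d ∷ [])     = zero
directionChanges (d ∷ e ∷ ds) =
  if does (d ≟ e) then directionChanges (e ∷ ds) else suc (directionChanges (e ∷ ds))

-- A path has two end points and traverses each of its grid edges once; it may
-- pass through a grid point more than once.  Since the edges are undirected,
-- trail in particular excludes turning back on the spot, so every change of
-- direction is a turn by a right angle.
record GridPath : Set where
  field
    start : Point
    steps : List Direction

  end : Point
  end = walkEnd start steps

  edges : List GridEdge
  edges = walkEdges start steps

  bends : ℕ
  bends = directionChanges steps

  field
    distinctEnds : start ≢ end
    trail        : Unique edges

open GridPath using (steps; edges; bends)

data Ascending : Direction → Set where
  right : Ascending right
  up    : Ascending up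

-- A staircase is listed from its lower left end.  Reversing the listing of a
-- path changes neither its edges nor its bends, so this choice does not affect
-- the existence of representations.
Monotonic : GridPath → Set
Monotonic P = All Ascending (steps P)

ShareEdge : GridPath → GridPath → Set
ShareEdge P Q = ∃[ e ] (e ∈ edges P × e ∈ edges Q)

record EPGRepresentation (G : Graph) : Set where
  open Graph G
  field
    path     : Vertex → GridPath
    adj⇔share : ∀ v w → v ≢ w → Adj v w ⇔ ShareEdge (path v) (path w)

open EPGRepresentation using (path)

B : ℕ → Graph → Set
B k G = ∃[ R ] (∀ (v : Graph.Vertex G) → bends (path {G} R v) ≤ k)

Bᵐ : ℕ → Graph → Set
Bᵐ ℓ G = ∃[ R ] (∀ (v : Graph.Vertex G) →
  Monotonic (path {G} R v) × bends (path {G} R v) ≤ ℓ)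

{-# OPTIONS --safe #-}
-- The witness is a bipartite intersection graph of "spines" and "bridges".  Among the spines there
-- are "across" paths, snakes with t ≈ (k + 1)/2 long rows, and "along" paths, transposed snakes with t
-- long columns.  The bridges are staircases of k + 1 unit edges that cover the crossing area almost
-- completely; each edge of a bridge lies on a different spine.
--
-- In a monotonic ℓ-bend representation, colour each edge of a bridge by the spine containing it.
-- Since k + 1 colours occur on the bridge, a colour is entered at least k times and a colour is left
-- at least k times.  Each of the at most ℓ bends accounts for one of these 2k events; any other event
-- is at an end of a straight piece of a spine, or is the second event at a bend where the bridge
-- switches directly from a spine P to a spine P′.  In the latter case the straight piece of P before
-- the bend determines the edge of P′ after it, because a monotonic path leaves each grid line only
-- once.  So there are at most ℓ + 1 switches for each ordered pair of spines with a common bridge.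
-- Across paths share a bridge only within blocks of t, and along paths are comparatively few, so
-- almost all of these pairs are mixed, and there are too few of them unless ℓ > 2k - 8.
module Submission where

open import Defs
open import Data.Bool.Base using (Bool; true; false; if_then_else_; not; _∧_)
open import Data.Empty using (⊥-elim)
open import Data.Fin.Base using (Fin; zero; suc; toℕ; fromℕ<; combine; remQuot)
open import Data.Fin.Properties as Fin
  using (toℕ<n; toℕ-injective; toℕ-fromℕ<; toℕ-combine; combine-injective; combine-remQuot;
         +↔⊎; *↔×; injective⇒≤)
open import Data.Integer.Base as ℤ using (ℤ; +_) renaming (suc to sucℤ; pred to predℤ)
import Data.Integer.Properties as ℤ
open import Data.List.Base
  using (List; []; _∷_; _++_; map; length; filter; concatMap; lookup; replicate; applyUpTo;
         applyDownFrom; allFin; cartesianProduct)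
open import Data.List.Membership.Propositional using (_∈_; find; lose)
open import Data.List.Membership.Propositional.Properties
  using (∈-lookup; ∈-filter⁺; ∈-filter⁻; ∈-++⁺ˡ; ∈-++⁺ʳ; ∈-++⁻; ∈-concatMap⁻; ∈-map⁺; ∈-map⁻;
         ∈-applyUpTo⁺; ∈-applyUpTo⁻; ∈-applyDownFrom⁺; ∈-applyDownFrom⁻; ∈-cartesianProduct⁺; ∈-allFin)
open import Data.List.Properties using (length-++; length-tabulate; length-map; map-++; filter-++)
open import Data.List.Relation.Unary.All as All using (All; []; _∷_)
open import Data.List.Relation.Unary.AllPairs using ([]; _∷_)
open import Data.List.Relation.Unary.Any using (Any; here; there; any?; index)
open import Data.List.Relation.Unary.Any.Properties using (lookup-index; map⁺)
open import Data.List.Relation.Unary.Unique.Propositional using (Unique)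
import Data.List.Relation.Unary.Unique.Propositional.Properties as Unique
open import Data.Maybe.Base using (Maybe; just; nothing)
open import Data.Maybe.Properties using (just-injective) renaming (≡-dec to ≡-decᴹ)
open import Data.Nat.Base
  using (ℕ; zero; suc; _≤_; _<_; _+_; _*_; _∸_; z≤n; s≤s; s≤s⁻¹; ⌊_/2⌋; ⌈_/2⌉)
open import Data.Nat.Divisibility using (_∣_)
open import Data.Nat.Properties as ℕ
  using (≤-refl; ≤-reflexive; ≤-trans; <-≤-trans; ≤-<-trans; <⇒≤; <⇒≢; <⇒≱; ≰⇒>; <-cmp; n≤1+n;
         m≤n⇒m≤1+n; m≤m+n; m≤n+m; m<m+n; +-comm; +-assoc; +-identityʳ; +-suc; +-mono-≤; +-monoˡ-≤;
         +-monoʳ-≤; +-monoˡ-<; +-monoʳ-<; +-mono-≤-<; +-mono-<-≤; +-cancelˡ-≤; +-cancelʳ-≤;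
         +-cancelˡ-≡; +-cancelʳ-≡; *-suc; *-distribˡ-+; *-mono-≤; *-monoʳ-≤; m∸n≤m; m∸n+n≡m;
         m+[n∸m]≡n; ∸-monoʳ-≤; ⌊n/2⌋-mono; ⌊n/2⌋≤⌈n/2⌉; ⌊n/2⌋+⌈n/2⌉≡n; module ≤-Reasoning)
open import Data.Nat.Tactic.RingSolver using (solve-∀)
open import Data.Product.Base using (_×_; _,_; ∃-syntax; proj₁; proj₂)
open import Data.Product.Function.NonDependent.Propositional using (_×-↔_)
open import Data.Product.Properties using () renaming (≡-dec to ≡-dec×)
open import Data.Sum.Base using (_⊎_; inj₁; inj₂)
open import Data.Sum.Function.Propositional using (_⊎-↔_)
open import Data.Sum.Properties using (inj₁-injective; inj₂-injective) renaming (≡-dec to ≡-decˢ)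
open import Function.Base using (_∘_; id)
open import Function.Bundles using (_↔_; Inverse; mk⇔; Equivalence)
open import Function.Properties.Inverse using (↔-trans; ↔-refl)
open import Relation.Binary.Definitions using (DecidableEquality; tri<; tri≈; tri>)
open import Relation.Binary.PropositionalEquality
  using (_≡_; _≢_; refl; sym; trans; cong; cong₂; subst; subst₂; ≢-sym; module ≡-Reasoning)
open import Relation.Nullary using (¬_; Dec; yes; no; does)
open import Relation.Nullary.Decidable using (_×-dec_; ¬?; map′)
open import Relation.Nullary.Negation using (contradiction)
open import Relation.Unary using () renaming (Decidable to Decidable₁)

open GridPath using (steps; edges; bends; start; trail; distinctEnds)

-- Counting in lists

lookup-injective : ∀ {X : Set} {xs : List X} → Unique xs →
  ∀ {i j} → lookup xs i ≡ lookup xs j → i ≡ j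
lookup-injective (x∉ ∷ u) {zero}  {zero}  _  = refl
lookup-injective (x∉ ∷ u) {zero}  {suc j} eq = contradiction eq (All.lookup x∉ (∈-lookup j))
lookup-injective (x∉ ∷ u) {suc i} {zero}  eq = contradiction (sym eq) (All.lookup x∉ (∈-lookup i))
lookup-injective (x∉ ∷ u) {suc i} {suc j} eq = cong suc (lookup-injective u eq)

-- Each position of `xs` is sent to the position of one related entry of `ys`, and this choice is
-- injective. Working with positions allows `ys` to have repetitions, and a relation serves where
-- the image is only known to exist.
pigeonhole : ∀ {X Y : Set} (R : X → Y → Set) {xs : List X} {ys : List Y} → Unique xs →
  (∀ {x} → x ∈ xs → Any (R x) ys) →
  (∀ {x x′ y} → x ∈ xs → x′ ∈ xs → R x y → R x′ y → x ≡ x′) →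
  length xs ≤ length ys
pigeonhole R {xs} {ys} u total injective = injective⇒≤ {f = λ i → index (image i)} λ {i} {j} eq →
  lookup-injective u (injective (∈-lookup i) (∈-lookup j) (lookup-index (image i))
    (subst (λ n → R (lookup xs j) (lookup ys n)) (sym eq) (lookup-index (image j))))
  where
  image : ∀ i → Any (R (lookup xs i)) ys
  image i = total (∈-lookup i)

length-concatMap-≤ : ∀ {X Y : Set} (f : X → List Y) m → (∀ x → length (f x) ≤ m) →
  ∀ xs → length (concatMap f xs) ≤ length xs * m
length-concatMap-≤ f m bound []       = z≤n
length-concatMap-≤ f m bound (x ∷ xs) rewrite length-++ (f x) {concatMap f xs} =
  +-mono-≤ (bound x) (length-concatMap-≤ f m bound xs)

∈-concatMap : ∀ {X Y : Set} (f : X → List Y) {x y xs} → x ∈ xs → y ∈ f x → y ∈ concatMap f xs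
∈-concatMap f (here refl)  y∈ = ∈-++⁺ˡ y∈
∈-concatMap f (there {x} x∈) y∈ = ∈-++⁺ʳ (f x) (∈-concatMap f x∈ y∈)

map-injective-on : ∀ {X Y : Set} (f : X → Y) {xs x y} → Unique (map f xs) →
  x ∈ xs → y ∈ xs → f x ≡ f y → x ≡ y
map-injective-on f (_ ∷ _)  (here refl) (here refl) _  = refl
map-injective-on f (n ∷ _)  (here refl) (there y∈)  eq = contradiction eq (All.lookup n (∈-map⁺ f y∈))
map-injective-on f (n ∷ _)  (there x∈)  (here refl) eq = contradiction (sym eq) (All.lookup n (∈-map⁺ f x∈))
map-injective-on f (_ ∷ u)  (there x∈)  (there y∈)  eq = map-injective-on f u x∈ y∈ eq

-- Monotonic paths

_≟ᵖ_ : DecidableEquality Point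
_≟ᵖ_ = ≡-dec× ℤ._≟_ ℤ._≟_

_≟ᵉ_ : DecidableEquality GridEdge
horizontal p ≟ᵉ horizontal q with p ≟ᵖ q
... | yes refl = yes refl
... | no  p≢q  = no λ { refl → p≢q refl }
horizontal _ ≟ᵉ vertical _   = no λ ()
vertical _   ≟ᵉ horizontal _ = no λ ()
vertical p   ≟ᵉ vertical q with p ≟ᵖ q
... | yes refl = yes refl
... | no  p≢q  = no λ { refl → p≢q refl }

open import Data.List.Membership.DecPropositional _≟ᵉ_ using (_∈?_)

edgeAt-injective : ∀ {d e p q} → Ascending d → Ascending e → edgeAt d p ≡ edgeAt e q → d ≡ e × p ≡ q
edgeAt-injective right right refl = refl , refl
edgeAt-injective up    up    refl = refl , refl

sucℤ-injective : ∀ {i j} → sucℤ i ≡ sucℤ j → i ≡ j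
sucℤ-injective {i} {j} eq = trans (sym (ℤ.pred-suc i)) (trans (cong predℤ eq) (ℤ.pred-suc j))

move-injective : ∀ {d} → Ascending d → ∀ {p q} → move d p ≡ move d q → p ≡ q
move-injective right eq = cong₂ _,_ (sucℤ-injective (cong proj₁ eq)) (cong proj₂ eq)
move-injective up    eq = cong₂ _,_ (cong proj₁ eq) (sucℤ-injective (cong proj₂ eq))

lowerLeft : GridEdge → Point
lowerLeft (horizontal p) = p
lowerLeft (vertical p)   = p

data Line : Set where
  row column : ℤ → Line

lineOf : GridEdge → Line
lineOf (horizontal (x , y)) = row y
lineOf (vertical   (x , y)) = column x

lineOf-move : ∀ {d} → Ascending d → ∀ p → lineOf (edgeAt d (move d p)) ≡ lineOf (edgeAt d p)
lineOf-move right p = refl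
lineOf-move up    p = refl

-- These edges stand for the maximal straight pieces of the walk: the last edge of each, hence one
-- more than there are bends.
pieceEnds : Point → List Direction → List GridEdge
pieceEnds p []           = []
pieceEnds p (d ∷ [])     = edgeAt d p ∷ []
pieceEnds p (d ∷ e ∷ ds) =
  if does (d ≟ e) then pieceEnds (move d p) (e ∷ ds) else edgeAt d p ∷ pieceEnds (move d p) (e ∷ ds)

-- Here `d` is the direction of the step that led to `p`, so the next edge is listed only if it
-- begins a new straight piece.
laterPieceStarts : Direction → Point → List Direction → List GridEdge
laterPieceStarts d p []       = []
laterPieceStarts d p (e ∷ ds) =
  if does (d ≟ e) then laterPieceStarts e (move e p) ds else edgeAt e p ∷ laterPieceStarts e (move e p) ds

pieceStarts : Point → List Direction → List GridEdge
pieceStarts p []       = []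
pieceStarts p (d ∷ ds) = edgeAt d p ∷ laterPieceStarts d (move d p) ds

length-if : ∀ {X : Set} b (x : X) {xs n} → length xs ≤ n →
  length (if b then xs else x ∷ xs) ≤ (if b then n else suc n)
length-if true  x le = le
length-if false x le = s≤s le

length-pieceEnds : ∀ p ds → length (pieceEnds p ds) ≤ suc (directionChanges ds)
length-pieceEnds p []           = z≤n
length-pieceEnds p (d ∷ [])     = ≤-refl
length-pieceEnds p (d ∷ e ∷ ds) = ≤-trans
  (length-if (does (d ≟ e)) (edgeAt d p) (length-pieceEnds (move d p) (e ∷ ds)))
  (≤-reflexive (if-suc (does (d ≟ e))))
  where
  if-suc : ∀ b {n : ℕ} → (if b then suc n else suc (suc n)) ≡ suc (if b then n else suc n)
  if-suc true  = refl
  if-suc false = refl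

length-laterPieceStarts : ∀ d p ds → length (laterPieceStarts d p ds) ≤ directionChanges (d ∷ ds)
length-laterPieceStarts d p []       = z≤n
length-laterPieceStarts d p (e ∷ ds) =
  length-if (does (d ≟ e)) (edgeAt e p) (length-laterPieceStarts e (move e p) ds)

length-pieceStarts : ∀ p ds → length (pieceStarts p ds) ≤ suc (directionChanges ds)
length-pieceStarts p []       = z≤n
length-pieceStarts p (d ∷ ds) = s≤s (length-laterPieceStarts d (move d p) ds)

-- After an edge the walk turns, stops or goes straight on; in the first two cases the edge ends its
-- piece. Among ascending steps the name of an edge determines its direction and starting point, so
-- the position of the edge on the walk can be read off.
∈-pieceEnds : ∀ {c} → Ascending c → ∀ {q} p {ds} → All Ascending ds → edgeAt c q ∈ walkEdges p ds →
  edgeAt c q ∈ pieceEnds p ds ⊎ edgeAt c (move c q) ∈ walkEdges p ds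
∈-pieceEnds ac p {d ∷ []} (ad ∷ [])    (here eq) = inj₁ (here eq)
∈-pieceEnds ac p {d ∷ e ∷ ds} (ad ∷ ads) (here eq) with edgeAt-injective ac ad eq | d ≟ e
... | refl , refl | yes refl = inj₂ (there (here refl))
... | refl , refl | no _     = inj₁ (here refl)
∈-pieceEnds ac p {d ∷ e ∷ ds} (ad ∷ ads) (there f∈) with ∈-pieceEnds ac (move d p) ads f∈ | does (d ≟ e)
... | inj₁ x | true  = inj₁ x
... | inj₁ x | false = inj₁ (there x)
... | inj₂ y | _     = inj₂ (there y)

∈-laterPieceStarts : ∀ {c} → Ascending c → ∀ {q d} → Ascending d → ∀ p {ds} → All Ascending ds →
  edgeAt c (move c q) ∈ walkEdges (move d p) ds →
  edgeAt c (move c q) ∈ laterPieceStarts d (move d p) ds ⊎ edgeAt c q ∈ walkEdges p (d ∷ ds)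
∈-laterPieceStarts ac {d = d} ad p {e ∷ ds} (ae ∷ ads) (here eq) with edgeAt-injective ac ae eq | d ≟ e
... | refl , mq≡mp | yes refl = inj₂ (here (cong (edgeAt d) (move-injective ac mq≡mp)))
... | refl , mq≡mp | no _     = inj₁ (here eq)
∈-laterPieceStarts ac {d = d} ad p {e ∷ ds} (ae ∷ ads) (there f∈)
  with ∈-laterPieceStarts ac ae (move d p) ads f∈ | does (d ≟ e)
... | inj₁ x | true  = inj₁ x
... | inj₁ x | false = inj₁ (there x)
... | inj₂ y | _     = inj₂ (there y)

∈-pieceStarts : ∀ {c} → Ascending c → ∀ {q} p {ds} → All Ascending ds →
  edgeAt c (move c q) ∈ walkEdges p ds →
  edgeAt c (move c q) ∈ pieceStarts p ds ⊎ edgeAt c q ∈ walkEdges p ds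
∈-pieceStarts ac p (ad ∷ ads) (here eq)  = inj₁ (here eq)
∈-pieceStarts ac p (ad ∷ ads) (there f∈) with ∈-laterPieceStarts ac ad p ads f∈
... | inj₁ x = inj₁ (there x)
... | inj₂ y = inj₂ y

-- A straight piece stays on one grid line, so its last edge already shows the line of all its
-- edges.
lineOf-∈-pieceEnds : ∀ p {ds f} → All Ascending ds → f ∈ walkEdges p ds →
  lineOf f ∈ map lineOf (pieceEnds p ds)
lineOf-∈-pieceEnds p {d ∷ []}     (ad ∷ ads) (here refl) = here refl
lineOf-∈-pieceEnds p {d ∷ e ∷ ds} (ad ∷ ads) (here refl)
  with d ≟ e | lineOf-∈-pieceEnds (move d p) ads (here refl)
... | yes refl | l∈ = subst (_∈ map lineOf (pieceEnds (move d p) (d ∷ ds))) (lineOf-move ad p) l∈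
... | no _     | l∈ = here refl
lineOf-∈-pieceEnds p {d ∷ e ∷ ds} (ad ∷ ads) (there f∈)
  with does (d ≟ e) | lineOf-∈-pieceEnds (move d p) ads f∈
... | true  | l∈ = l∈
... | false | l∈ = there l∈

below : Point → GridEdge → Set
below (x , y) (horizontal (u , v)) = x ℤ.≤ u × y ℤ.≤ v
below (x , y) (vertical   (u , v)) = x ℤ.≤ u × y ℤ.≤ v

below-move : ∀ {d} → Ascending d → ∀ p f → below (move d p) f → below p f
below-move right (x , y) (horizontal _) (a , b) = ℤ.≤-trans (ℤ.i≤suc[i] x) a , b
below-move right (x , y) (vertical _)   (a , b) = ℤ.≤-trans (ℤ.i≤suc[i] x) a , b
below-move up    (x , y) (horizontal _) (a , b) = a , ℤ.≤-trans (ℤ.i≤suc[i] y) b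
below-move up    (x , y) (vertical _)   (a , b) = a , ℤ.≤-trans (ℤ.i≤suc[i] y) b

start-below : ∀ p {ds f} → All Ascending ds → f ∈ walkEdges p ds → below p f
start-below p (right ∷ ads) (here refl)        = ℤ.≤-refl , ℤ.≤-refl
start-below p (up ∷ ads)    (here refl)        = ℤ.≤-refl , ℤ.≤-refl
start-below p {d ∷ ds} {f} (ad ∷ ads) (there f∈) = below-move ad p f (start-below (move d p) ads f∈)

suc≰ : ∀ i → ¬ sucℤ i ℤ.≤ i
suc≰ i le = ℤ.<-irrefl refl (ℤ.suc[i]≤j⇒i<j le)

-- After the step up from height `y` everything later on the walk has height at least `y + 1`, so
-- the walk rises from each row only once.
ascending-vertical : ∀ p {ds x x′ y} → All Ascending ds →
  vertical (x , y) ∈ walkEdges p ds → vertical (x′ , y) ∈ walkEdges p ds → x ≡ x′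
ascending-vertical p (up ∷ _)   (here refl) (here refl) = refl
ascending-vertical p (up ∷ ads) (here refl) (there g∈)  = ⊥-elim (suc≰ _ (proj₂ (start-below _ ads g∈)))
ascending-vertical p (up ∷ ads) (there f∈)  (here refl) = ⊥-elim (suc≰ _ (proj₂ (start-below _ ads f∈)))
ascending-vertical p (_ ∷ ads)  (there f∈)  (there g∈)  = ascending-vertical _ ads f∈ g∈
ascending-vertical p (right ∷ _) (here ()) _
ascending-vertical p (right ∷ _) _ (here ())

ascending-horizontal : ∀ p {ds x y y′} → All Ascending ds →
  horizontal (x , y) ∈ walkEdges p ds → horizontal (x , y′) ∈ walkEdges p ds → y ≡ y′
ascending-horizontal p (right ∷ _)   (here refl) (here refl) = refl
ascending-horizontal p (right ∷ ads) (here refl) (there g∈)  = ⊥-elim (suc≰ _ (proj₁ (start-below _ ads g∈)))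
ascending-horizontal p (right ∷ ads) (there f∈)  (here refl) = ⊥-elim (suc≰ _ (proj₁ (start-below _ ads f∈)))
ascending-horizontal p (_ ∷ ads)     (there f∈)  (there g∈)  = ascending-horizontal _ ads f∈ g∈
ascending-horizontal p (up ∷ _) (here ()) _
ascending-horizontal p (up ∷ _) _ (here ())

-- Colour changes along a path

-- A junction is a pair of consecutive steps; `origin` is the point before the incoming step, not
-- the common point of the two edges.
record Junction : Set where
  constructor junction
  field
    origin   : Point
    incoming : Direction
    outgoing : Direction

  before : GridEdge
  before = edgeAt incoming origin

  after : GridEdge
  after = edgeAt outgoing (move incoming origin)

open Junction

junctions : Point → List Direction → List Junction
junctions p []           = []
junctions p (d ∷ [])     = []
junctions p (d ∷ e ∷ ds) = junction p d e ∷ junctions (move d p) (e ∷ ds)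

map-after-junctions : ∀ p d ds → map after (junctions p (d ∷ ds)) ≡ walkEdges (move d p) ds
map-after-junctions p d []       = refl
map-after-junctions p d (e ∷ ds) = cong (_ ∷_) (map-after-junctions (move d p) e ds)

before∈walkEdges : ∀ p ds {J} → J ∈ junctions p ds → before J ∈ walkEdges p ds
before∈walkEdges p (d ∷ e ∷ ds) (here refl) = here refl
before∈walkEdges p (d ∷ e ∷ ds) (there J∈)  = there (before∈walkEdges (move d p) (e ∷ ds) J∈)

after∈walkEdges : ∀ p ds {J} → J ∈ junctions p ds → after J ∈ walkEdges p ds
after∈walkEdges p (d ∷ ds) J∈ =
  there (subst (_ ∈_) (map-after-junctions p d ds) (∈-map⁺ after J∈))

unique-after : ∀ p ds → Unique (walkEdges p ds) → Unique (map after (junctions p ds))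
unique-after p []       _       = []
unique-after p (d ∷ ds) (_ ∷ u) = subst Unique (sym (map-after-junctions p d ds)) u

unique-before : ∀ p ds → Unique (walkEdges p ds) → Unique (map before (junctions p ds))
unique-before p []           _       = []
unique-before p (d ∷ [])     _       = []
unique-before p (d ∷ e ∷ ds) (f∉ ∷ u) =
  All.tabulate (λ g∈ → All.lookup f∉ (earlier g∈)) ∷ unique-before (move d p) (e ∷ ds) u
  where
  earlier : ∀ {g} → g ∈ map before (junctions (move d p) (e ∷ ds)) → g ∈ walkEdges (move d p) (e ∷ ds)
  earlier g∈ with ∈-map⁻ before g∈
  ... | J , J∈ , refl = before∈walkEdges (move d p) (e ∷ ds) J∈

ascending-junction : ∀ p ds → All Ascending ds → ∀ {J} → J ∈ junctions p ds →
  Ascending (incoming J) × Ascending (outgoing J)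
ascending-junction p (d ∷ e ∷ ds) (ad ∷ ae ∷ _)  (here refl) = ad , ae
ascending-junction p (d ∷ e ∷ ds) (_ ∷ ads)      (there J∈)  = ascending-junction (move d p) (e ∷ ds) ads J∈

indicator : Bool → ℕ
indicator b = if b then 1 else 0

length-filter-∷ : ∀ {X : Set} {P : X → Set} (P? : Decidable₁ P) x xs →
  length (filter P? (x ∷ xs)) ≡ indicator (does (P? x)) + length (filter P? xs)
length-filter-∷ P? x xs with does (P? x)
... | true  = refl
... | false = refl

Any-filter-∷ : ∀ {X : Set} {P Q : X → Set} (P? : Decidable₁ P) x {xs} →
  Any Q (filter P? xs) → Any Q (filter P? (x ∷ xs))
Any-filter-∷ P? x q with does (P? x)
... | true  = there q
... | false = q

module Coloured {I : Set} (_≟ᴵ_ : DecidableEquality I) (colour : GridEdge → Maybe I) where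

  _≟ᶜ_ : DecidableEquality (Maybe I)
  _≟ᶜ_ = ≡-decᴹ _≟ᴵ_

  -- The colour `nothing` belongs to edges outside of all spines. A change from one spine directly
  -- to another is both an `Enter` and a `Leave`, whereas a change from or to `nothing` is only one
  -- of them.
  Straight Enter Leave : Junction → Set
  Straight J = incoming J ≡ outgoing J
  Enter    J = colour (after J) ≢ nothing × colour (before J) ≢ colour (after J)
  Leave    J = colour (before J) ≢ nothing × colour (before J) ≢ colour (after J)

  straight? : Decidable₁ Straight
  straight? J = incoming J ≟ outgoing J

  enter? : Decidable₁ Enter
  enter? J = ¬? (colour (after J) ≟ᶜ nothing) ×-dec ¬? (colour (before J) ≟ᶜ colour (after J))

  leave? : Decidable₁ Leave
  leave? J = ¬? (colour (before J) ≟ᶜ nothing) ×-dec ¬? (colour (before J) ≟ᶜ colour (after J))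

  StraightEnter StraightLeave Switch : Junction → Set
  StraightEnter J = Straight J × Enter J
  StraightLeave J = Straight J × Leave J
  Switch        J = ¬ Straight J × Enter J × Leave J

  straightEnter? : Decidable₁ StraightEnter
  straightEnter? J = straight? J ×-dec enter? J

  straightLeave? : Decidable₁ StraightLeave
  straightLeave? J = straight? J ×-dec leave? J

  switch? : Decidable₁ Switch
  switch? J = ¬? (straight? J) ×-dec (enter? J ×-dec leave? J)

  -- This counts the events that bends do not pay for when each bend pays for one event: every event
  -- at a straight junction, and the second event at a bend that has both.
  excess : List Junction → ℕ
  excess Js = length (filter straightEnter? Js) + length (filter straightLeave? Js) +
              length (filter switch? Js)

  excess-++ : ∀ Js Ks → excess (Js ++ Ks) ≡ excess Js + excess Ks
  excess-++ Js Ks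
    rewrite filter-++ straightEnter? Js Ks | filter-++ straightLeave? Js Ks | filter-++ switch? Js Ks
          | length-++ (filter straightEnter? Js) {filter straightEnter? Ks}
          | length-++ (filter straightLeave? Js) {filter straightLeave? Ks}
          | length-++ (filter switch? Js) {filter switch? Ks} =
      interchange (length (filter straightEnter? Js)) (length (filter straightLeave? Js)) _ _ _ _
    where
    interchange : ∀ a b c d e f → (a + d) + (b + e) + (c + f) ≡ (a + b + c) + (d + e + f)
    interchange = solve-∀

  enter+leave≤changes+excess : ∀ p ds →
    length (filter enter? (junctions p ds)) + length (filter leave? (junctions p ds)) ≤
    directionChanges ds + excess (junctions p ds)
  enter+leave≤changes+excess p []           = z≤n
  enter+leave≤changes+excess p (d ∷ [])     = z≤n
  enter+leave≤changes+excess p (d ∷ e ∷ ds)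
    = subst₂ _≤_
        (sym (cong₂ _+_ (length-filter-∷ enter? J Js) (length-filter-∷ leave? J Js)))
        (sym (cong₂ _+_ (changes-∷ (does (d ≟ e)) (directionChanges (e ∷ ds)))
          (cong₂ _+_ (cong₂ _+_ (length-filter-∷ straightEnter? J Js) (length-filter-∷ straightLeave? J Js))
            (length-filter-∷ switch? J Js))))
        (step (does (d ≟ e)) (does (enter? J)) (does (leave? J)) _ _ _ _ _ _
          (enter+leave≤changes+excess (move d p) (e ∷ ds)))
    where
    J  = junction p d e
    Js = junctions (move d p) (e ∷ ds)

    changes-∷ : ∀ b n → (if b then n else suc n) ≡ indicator (not b) + n
    changes-∷ true  n = refl
    changes-∷ false n = refl

    -- The charging rule at a single junction, where `s`, `e` and `l` say whether it is straight, an
    -- entry and an exit; the inductive step then only rearranges sums.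
    local : ∀ s e l → indicator e + indicator l ≤
      indicator (not s) + (indicator (s ∧ e) + indicator (s ∧ l) + indicator (not s ∧ (e ∧ l)))
    local true  true  true  = ≤-refl
    local true  true  false = ≤-refl
    local true  false true  = ≤-refl
    local true  false false = ≤-refl
    local false true  true  = ≤-refl
    local false true  false = ≤-refl
    local false false true  = ≤-refl
    local false false false = z≤n

    step : ∀ s e l a b c x y z → a + b ≤ c + (x + y + z) →
      (indicator e + a) + (indicator l + b) ≤
      (indicator (not s) + c) +
        ((indicator (s ∧ e) + x) + (indicator (s ∧ l) + y) + (indicator (not s ∧ (e ∧ l)) + z))
    step s e l a b c x y z a+b≤ = subst₂ _≤_
      (regroup₂ (indicator e) (indicator l) a b)
      (regroup₄ (indicator (not s)) (indicator (s ∧ e)) (indicator (s ∧ l)) (indicator (not s ∧ (e ∧ l))) c x y z)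
      (+-mono-≤ (local s e l) a+b≤)
      where
      regroup₂ : ∀ i j a b → (i + j) + (a + b) ≡ (i + a) + (j + b)
      regroup₂ = solve-∀
      regroup₄ : ∀ i j k l a b c d → (i + (j + k + l)) + (a + (b + c + d)) ≡
        (i + a) + ((j + b) + (k + c) + (l + d))
      regroup₄ = solve-∀

  Coloured-as : I → List GridEdge → Set
  Coloured-as i es = Any (λ f → colour f ≡ just i) es

  just≢nothing : ∀ {i : I} {x} → x ≡ just i → x ≢ nothing
  just≢nothing refl ()

  -- The first occurrence of the colour is either the first edge of the walk or is preceded by an
  -- edge of another colour, which makes an `Enter` junction.
  entered : ∀ {i} p d ds → Coloured-as i (walkEdges p (d ∷ ds)) →
    colour (edgeAt d p) ≡ just i ⊎
    Any (λ J → colour (after J) ≡ just i) (filter enter? (junctions p (d ∷ ds)))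
  entered p d ds           (here eq) = inj₁ eq
  entered {i} p d (e ∷ ds) (there c) with entered (move d p) e ds c
  ... | inj₂ J∈ = inj₂ (Any-filter-∷ enter? _ J∈)
  ... | inj₁ eq with colour (edgeAt d p) ≟ᶜ just i
  ...   | yes eq′ = inj₁ eq′
  ...   | no neq  = inj₂ (lose (∈-filter⁺ enter? (here refl)
                           (just≢nothing eq , λ eq″ → neq (trans eq″ eq))) eq)

  lastEdge : Point → Direction → List Direction → GridEdge
  lastEdge p d []       = edgeAt d p
  lastEdge p d (e ∷ ds) = lastEdge (move d p) e ds

  -- The mirror image of `entered`, at the last occurrence of the colour. If the next edge has the
  -- same colour, the search moves on to it.
  left-behind : ∀ {i} p d ds → Coloured-as i (walkEdges p (d ∷ ds)) →
    colour (lastEdge p d ds) ≡ just i ⊎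
    Any (λ J → colour (before J) ≡ just i) (filter leave? (junctions p (d ∷ ds)))
  left-behind p d []           (here eq) = inj₁ eq
  left-behind {i} p d (e ∷ ds) (there c) with left-behind (move d p) e ds c
  ... | inj₁ eq = inj₁ eq
  ... | inj₂ J∈ = inj₂ (Any-filter-∷ leave? _ J∈)
  left-behind {i} p d (e ∷ ds) (here eq) with colour (edgeAt e (move d p)) ≟ᶜ just i
  ... | no neq  = inj₂ (lose (∈-filter⁺ leave? (here refl)
                         (just≢nothing eq , λ eq″ → neq (trans (sym eq″) eq))) eq)
  ... | yes eq′ with left-behind (move d p) e ds (here eq′)
  ...   | inj₁ eq″ = inj₁ eq″
  ...   | inj₂ J∈  = inj₂ (Any-filter-∷ leave? _ J∈)

  -- The exceptional edge has at most one colour, so all colours but one are witnessed by different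
  -- junctions. The edge `first` is the first edge of the walk when entries are counted and its last
  -- edge when exits are counted.
  length-colours : ∀ {cs Js first} (end : Junction → GridEdge) → Unique cs →
    (∀ {i} → i ∈ cs → colour first ≡ just i ⊎ Any (λ J → colour (end J) ≡ just i) Js) →
    length cs ≤ suc (length Js)
  length-colours {cs} {Js} {first} end u seen =
    subst (λ n → length cs ≤ suc n) (length-map end Js)
      (pigeonhole (λ i f → colour f ≡ just i) {ys = first ∷ map end Js} u
        (λ i∈ → witness (seen i∈))
        (λ _ _ eq eq′ → just-injective (trans (sym eq) eq′)))
    where
    witness : ∀ {i} → colour first ≡ just i ⊎ Any (λ J → colour (end J) ≡ just i) Js →
      Any (λ f → colour f ≡ just i) (first ∷ map end Js)
    witness (inj₁ eq) = here eq
    witness (inj₂ J∈) = there (map⁺ J∈)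

  colours≤bends : ∀ p ds {cs s} → Unique cs → length cs ≡ suc s →
    (∀ {i} → i ∈ cs → Coloured-as i (walkEdges p ds)) →
    s + s ≤ directionChanges ds + excess (junctions p ds)
  colours≤bends p [] {i ∷ cs} _ _ coloured with coloured (here refl)
  ... | ()
  colours≤bends p (d ∷ ds) {cs} {s} u len coloured = ≤-trans
    (+-mono-≤ (s≤s⁻¹ (subst (_≤ _) len (length-colours after u (λ i∈ → entered p d ds (coloured i∈)))))
              (s≤s⁻¹ (subst (_≤ _) len (length-colours before u (λ i∈ → left-behind p d ds (coloured i∈))))))
    (enter+leave≤changes+excess p (d ∷ ds))

-- Double counting over all bridges of a monotonic representation

module MonotoneBound
  {I J : Set} (_≟ᴵ_ : DecidableEquality I) (As : List I) (Bs : List J)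
  (PA : I → GridPath) (PB : J → GridPath) (ℓ : ℕ)
  (ascendingA : ∀ i → Monotonic (PA i)) (ascendingB : ∀ j → Monotonic (PB j))
  (bendsA : ∀ i → bends (PA i) ≤ ℓ) (bendsB : ∀ j → bends (PB j) ≤ ℓ)
  (complete : ∀ i → i ∈ As) (uniqueBs : Unique Bs)
  (disjointA : ∀ {i i′ e} → e ∈ edges (PA i) → e ∈ edges (PA i′) → i ≡ i′)
  (disjointB : ∀ {j j′ e} → e ∈ edges (PB j) → e ∈ edges (PB j′) → j ≡ j′)
  where

  owner? : ∀ e → Dec (Any (λ i → e ∈ edges (PA i)) As)
  owner? e = any? (λ i → e ∈? edges (PA i)) As

  colour : GridEdge → Maybe I
  colour e with owner? e
  ... | yes owned = just (proj₁ (find owned))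
  ... | no _      = nothing

  colour-sound : ∀ {e i} → colour e ≡ just i → e ∈ edges (PA i)
  colour-sound {e} eq with owner? e
  colour-sound refl | yes owned = proj₂ (proj₂ (find owned))

  -- The search through `As` reaches every spine, and disjointness forces the owner that it finds to
  -- be `i`.
  colour-complete : ∀ {e i} → e ∈ edges (PA i) → colour e ≡ just i
  colour-complete {e} {i} e∈ with owner? e
  ... | yes owned = cong just (disjointA (proj₂ (proj₂ (find owned))) e∈)
  ... | no ¬owned = ⊥-elim (¬owned (lose (complete i) e∈))

  owned : ∀ {e} → colour e ≢ nothing → ∃[ i ] colour e ≡ just i
  owned {e} neq with colour e
  ... | just i  = i , refl
  ... | nothing = ⊥-elim (neq refl)

  open Coloured _≟ᴵ_ colour

  junctionsB : J → List Junction
  junctionsB j = junctions (start (PB j)) (steps (PB j))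

  allJunctions : List Junction
  allJunctions = concatMap junctionsB Bs

  source : ∀ {K} → K ∈ allJunctions → ∃[ j ] (K ∈ junctionsB j)
  source K∈ with find (∈-concatMap⁻ junctionsB {xs = Bs} K∈)
  ... | j , _ , K∈j = j , K∈j

  -- No edge repeats within one bridge because it is a trail, nor across two bridges because they
  -- are edge-disjoint. Thus a junction is determined by either of its edges, and counting junctions
  -- becomes counting edges.
  unique-ends : (end : Junction → GridEdge) →
    (∀ j {K} → K ∈ junctionsB j → end K ∈ edges (PB j)) →
    (∀ j → Unique (map end (junctionsB j))) → Unique (map end allJunctions)
  unique-ends end end∈ unique = go Bs uniqueBs
    where
    go : ∀ js → Unique js → Unique (map end (concatMap junctionsB js))
    go []       _        = []
    go (j ∷ js) (j∉ ∷ u) = subst Unique (sym (map-++ end (junctionsB j) _))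
      (Unique.++⁺ (unique j) (go js u) disjoint)
      where
      disjoint : ∀ {e} → ¬ (e ∈ map end (junctionsB j) × e ∈ map end (concatMap junctionsB js))
      disjoint (e∈ , e∈′) with ∈-map⁻ end e∈ | ∈-map⁻ end e∈′
      ... | K , K∈ , refl | K′ , K′∈ , eq with find (∈-concatMap⁻ junctionsB {xs = js} K′∈)
      ... | j′ , j′∈ , K′∈j′ = All.lookup j∉ j′∈
              (disjointB (end∈ j K∈) (subst (_∈ edges (PB j′)) (sym eq) (end∈ j′ K′∈j′)))

  before∈ : ∀ j {K} → K ∈ junctionsB j → before K ∈ edges (PB j)
  before∈ j = before∈walkEdges (start (PB j)) (steps (PB j))

  after∈ : ∀ j {K} → K ∈ junctionsB j → after K ∈ edges (PB j)
  after∈ j = after∈walkEdges (start (PB j)) (steps (PB j))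

  before-injective : ∀ {K K′} → K ∈ allJunctions → K′ ∈ allJunctions → before K ≡ before K′ → K ≡ K′
  before-injective = map-injective-on before
    (unique-ends before before∈ (λ j → unique-before (start (PB j)) (steps (PB j)) (trail (PB j))))

  after-injective : ∀ {K K′} → K ∈ allJunctions → K′ ∈ allJunctions → after K ≡ after K′ → K ≡ K′
  after-injective = map-injective-on after
    (unique-ends after after∈ (λ j → unique-after (start (PB j)) (steps (PB j)) (trail (PB j))))

  unique-allJunctions : Unique allJunctions
  unique-allJunctions = Unique.map⁻ (unique-ends after after∈
    (λ j → unique-after (start (PB j)) (steps (PB j)) (trail (PB j))))

  ascending : ∀ {K} → K ∈ allJunctions → Ascending (incoming K) × Ascending (outgoing K)
  ascending K∈ with source K∈
  ... | j , K∈j = ascending-junction (start (PB j)) (steps (PB j)) (ascendingB j) K∈j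

  endsA startsA : I → List GridEdge
  endsA   i = pieceEnds   (start (PA i)) (steps (PA i))
  startsA i = pieceStarts (start (PA i)) (steps (PA i))

  -- When a bridge goes straight on while leaving spine `i`, the next edge of that line is not on
  -- the spine, so a straight piece of the spine ends there. A spine has at most `ℓ + 1` pieces.
  straightLeave-bound : length (filter straightLeave? allJunctions) ≤ length As * suc ℓ
  straightLeave-bound = ≤-trans
    (pigeonhole (λ K e → before K ≡ e) {ys = concatMap endsA As} (Unique.filter⁺ straightLeave? unique-allJunctions) total
      (λ K∈ K′∈ eq eq′ → before-injective (proj₁ (∈-filter⁻ straightLeave? {xs = allJunctions} K∈))
        (proj₁ (∈-filter⁻ straightLeave? {xs = allJunctions} K′∈)) (trans eq (sym eq′))))
    (length-concatMap-≤ endsA (suc ℓ)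
      (λ i → ≤-trans (length-pieceEnds (start (PA i)) (steps (PA i))) (s≤s (bendsA i))) As)
    where
    total : ∀ {K} → K ∈ filter straightLeave? allJunctions → before K ∈ concatMap endsA As
    total {junction p d _} K∈ with ∈-filter⁻ straightLeave? {xs = allJunctions} K∈
    ... | K∈all , refl , coloured , changes with owned coloured
    ... | i , eq with ∈-pieceEnds (proj₁ (ascending K∈all)) (start (PA i)) (ascendingA i) (colour-sound eq)
    ... | inj₁ last = ∈-concatMap endsA (complete i) last
    -- If the spine continued straight, the next edge of the bridge would have the same colour and
    -- nothing would be left.
    ... | inj₂ next = ⊥-elim (changes (trans eq (sym (colour-complete next))))

  straightEnter-bound : length (filter straightEnter? allJunctions) ≤ length As * suc ℓ
  straightEnter-bound = ≤-trans
    (pigeonhole (λ K e → after K ≡ e) {ys = concatMap startsA As} (Unique.filter⁺ straightEnter? unique-allJunctions) total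
      (λ K∈ K′∈ eq eq′ → after-injective (proj₁ (∈-filter⁻ straightEnter? {xs = allJunctions} K∈))
        (proj₁ (∈-filter⁻ straightEnter? {xs = allJunctions} K′∈)) (trans eq (sym eq′))))
    (length-concatMap-≤ startsA (suc ℓ)
      (λ i → ≤-trans (length-pieceStarts (start (PA i)) (steps (PA i))) (s≤s (bendsA i))) As)
    where
    total : ∀ {K} → K ∈ filter straightEnter? allJunctions → after K ∈ concatMap startsA As
    total {junction p d _} K∈ with ∈-filter⁻ straightEnter? {xs = allJunctions} K∈
    ... | K∈all , refl , coloured , changes with owned coloured
    ... | i , eq with ∈-pieceStarts (proj₁ (ascending K∈all)) (start (PA i)) (ascendingA i) (colour-sound eq)
    ... | inj₁ first = ∈-concatMap startsA (complete i) first
    ... | inj₂ prev  = ⊥-elim (changes (trans (colour-complete prev) (sym eq)))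

  -- Equal incoming lines force equal incoming directions, so both outgoing edges leave the same
  -- line perpendicularly. An ascending path has only one such edge for each line.
  switch-determined : ∀ {i p d e p′ d′ e′} → Ascending d → Ascending e → Ascending d′ → Ascending e′ →
    d ≢ e → d′ ≢ e′ → lineOf (edgeAt d p) ≡ lineOf (edgeAt d′ p′) →
    edgeAt e (move d p) ∈ edges (PA i) → edgeAt e′ (move d′ p′) ∈ edges (PA i) →
    edgeAt e (move d p) ≡ edgeAt e′ (move d′ p′)
  switch-determined right right _     _     d≢e _ _ _ _ = ⊥-elim (d≢e refl)
  switch-determined up    up    _     _     d≢e _ _ _ _ = ⊥-elim (d≢e refl)
  switch-determined _     _     right right _ d≢e _ _ _ = ⊥-elim (d≢e refl)
  switch-determined _     _     up    up    _ d≢e _ _ _ = ⊥-elim (d≢e refl)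
  switch-determined right up    up    right _ _ () _ _
  switch-determined up    right right up    _ _ () _ _
  switch-determined {i} right up right up _ _ refl f∈ f′∈ =
    cong (λ x → vertical (x , _)) (ascending-vertical (start (PA i)) (ascendingA i) f∈ f′∈)
  switch-determined {i} up right up right _ _ refl f∈ f′∈ =
    cong (λ y → horizontal (_ , y)) (ascending-horizontal (start (PA i)) (ascendingA i) f∈ f′∈)

  module _ (Pairs : List (I × I))
    (pairs : ∀ j {i i′} → ShareEdge (PA i) (PB j) → ShareEdge (PA i′) (PB j) → (i , i′) ∈ Pairs) where

    -- One token for each straight piece of the first spine of the pair. Recording the line of the
    -- piece is enough, since by `switch-determined` the line and the second spine fix the switch.
    tokens : I × I → List ((I × I) × Line)
    tokens (i , i′) = map ((i , i′) ,_) (map lineOf (endsA i))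

    length-tokens : ∀ ii → length (tokens ii) ≤ suc ℓ
    length-tokens (i , i′)
      rewrite length-map ((i , i′) ,_) (map lineOf (endsA i)) | length-map lineOf (endsA i) =
      ≤-trans (length-pieceEnds (start (PA i)) (steps (PA i))) (s≤s (bendsA i))

    SwitchToken : Junction → (I × I) × Line → Set
    SwitchToken K ((i , i′) , l) =
      before K ∈ edges (PA i) × after K ∈ edges (PA i′) × lineOf (before K) ≡ l

    switch-bound : length (filter switch? allJunctions) ≤ length Pairs * suc ℓ
    switch-bound = ≤-trans
      (pigeonhole SwitchToken {ys = concatMap tokens Pairs} (Unique.filter⁺ switch? unique-allJunctions) total injective)
      (length-concatMap-≤ tokens (suc ℓ) length-tokens Pairs)
      where
      total : ∀ {K} → K ∈ filter switch? allJunctions → Any (SwitchToken K) (concatMap tokens Pairs)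
      total {K} K∈ with ∈-filter⁻ switch? {xs = allJunctions} K∈
      ... | K∈all , _ , (colouredᵃ , _) , (colouredᵇ , _) with source K∈all | owned colouredᵇ | owned colouredᵃ
      ... | j , K∈j | i , eq | i′ , eq′ = lose
        (∈-concatMap tokens
          (pairs j (_ , colour-sound eq , before∈ j K∈j) (_ , colour-sound eq′ , after∈ j K∈j))
          (∈-map⁺ ((i , i′) ,_) (lineOf-∈-pieceEnds (start (PA i)) (ascendingA i) (colour-sound eq))))
        (colour-sound eq , colour-sound eq′ , refl)

      injective : ∀ {K K′ y} → K ∈ filter switch? allJunctions → K′ ∈ filter switch? allJunctions →
        SwitchToken K y → SwitchToken K′ y → K ≡ K′
      injective {K} {K′} {(i , i′) , l} K∈ K′∈ (_ , f∈ , eq) (_ , f′∈ , eq′)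
        with ∈-filter⁻ switch? {xs = allJunctions} K∈ | ∈-filter⁻ switch? {xs = allJunctions} K′∈
      ... | K∈all , turn , _ | K′∈all , turn′ , _ with ascending K∈all | ascending K′∈all
      ... | ad , ae | ad′ , ae′ = after-injective K∈all K′∈all
        (switch-determined {i′} {origin K} {p′ = origin K′} ad ae ad′ ae′ turn turn′ (trans eq (sym eq′)) f∈ f′∈)

    -- Every bridge satisfies `k + k ≤ ℓ + excess`. Summed over all bridges, the excess splits into
    -- straight entries, straight exits and switches; the first two are bounded by the pieces of
    -- spines and the last by the tokens.
    counting : ∀ k (nb : J → List I) → (∀ j → Unique (nb j)) → (∀ j → length (nb j) ≡ suc k) →
      (∀ j {i} → i ∈ nb j → ShareEdge (PA i) (PB j)) →
      length Bs * (k + k) ≤ length Bs * ℓ + (length As + length As + length Pairs) * suc ℓ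
    counting k nb unique-nb length-nb meets = ≤-trans (sum Bs) (+-monoʳ-≤ (length Bs * ℓ) (≤-trans
      (+-mono-≤ (+-mono-≤ straightEnter-bound straightLeave-bound) switch-bound)
      (≤-reflexive (factor (length As) (length Pairs) (suc ℓ)))))
      where
      factor : ∀ a p m → a * m + a * m + p * m ≡ (a + a + p) * m
      factor = solve-∀

      single : ∀ j → k + k ≤ ℓ + excess (junctionsB j)
      single j = ≤-trans
        (colours≤bends (start (PB j)) (steps (PB j)) (unique-nb j) (length-nb j) coloured)
        (+-monoˡ-≤ (excess (junctionsB j)) (bendsB j))
        where
        coloured : ∀ {i} → i ∈ nb j → Coloured-as i (edges (PB j))
        coloured i∈ with meets j i∈
        ... | e , e∈A , e∈B = lose e∈B (colour-complete e∈A)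

      regroup : ∀ l m x y → (l + x) + (m + y) ≡ (l + m) + (x + y)
      regroup = solve-∀

      sum : ∀ js → length js * (k + k) ≤ length js * ℓ + excess (concatMap junctionsB js)
      sum []       = z≤n
      sum (j ∷ js) = subst (k + k + length js * (k + k) ≤_)
        (trans (regroup ℓ (length js * ℓ) (excess (junctionsB j)) _)
          (cong (λ m → ℓ + length js * ℓ + m) (sym (excess-++ (junctionsB j) (concatMap junctionsB js)))))
        (+-mono-≤ (single j) (sum js))

-- Snakes and staircases

walkEdges-++ : ∀ p ds es → walkEdges p (ds ++ es) ≡ walkEdges p ds ++ walkEdges (walkEnd p ds) es
walkEdges-++ p []       es = refl
walkEdges-++ p (d ∷ ds) es = cong (_ ∷_) (walkEdges-++ (move d p) ds es)

walkEnd-++ : ∀ p ds es → walkEnd p (ds ++ es) ≡ walkEnd (walkEnd p ds) es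
walkEnd-++ p []       es = refl
walkEnd-++ p (d ∷ ds) es = walkEnd-++ (move d p) ds es

applyUpTo-cong : ∀ {X : Set} {f g : ℕ → X} → (∀ i → f i ≡ g i) → ∀ n → applyUpTo f n ≡ applyUpTo g n
applyUpTo-cong eq zero    = refl
applyUpTo-cong eq (suc n) = cong₂ _∷_ (eq 0) (applyUpTo-cong (λ i → eq (suc i)) n)

walkEdges-right : ∀ x y n →
  walkEdges (+ x , y) (replicate n right) ≡ applyUpTo (λ i → horizontal (+ (i + x) , y)) n
walkEdges-right x y zero    = refl
walkEdges-right x y (suc n) = cong (_ ∷_) (trans (walkEdges-right (suc x) y n)
  (applyUpTo-cong (λ i → cong (λ z → horizontal (+ z , y)) (+-suc i x)) n))

walkEdges-left : ∀ x y n →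
  walkEdges (+ (n + x) , y) (replicate n left) ≡ applyDownFrom (λ i → horizontal (+ (i + x) , y)) n
walkEdges-left x y zero    = refl
walkEdges-left x y (suc n) = cong (horizontal (+ (n + x) , y) ∷_) (walkEdges-left x y n)

walkEdges-up : ∀ x y n →
  walkEdges (x , + y) (replicate n up) ≡ applyUpTo (λ i → vertical (x , + (i + y))) n
walkEdges-up x y zero    = refl
walkEdges-up x y (suc n) = cong (_ ∷_) (trans (walkEdges-up x (suc y) n)
  (applyUpTo-cong (λ i → cong (λ z → vertical (x , + z)) (+-suc i y)) n))

walkEnd-right : ∀ x y n → walkEnd (+ x , y) (replicate n right) ≡ (+ (n + x) , y)
walkEnd-right x y zero    = refl
walkEnd-right x y (suc n) = trans (walkEnd-right (suc x) y n) (cong (λ z → + z , y) (+-suc n x))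

walkEnd-left : ∀ x y n → walkEnd (+ (n + x) , y) (replicate n left) ≡ (+ x , y)
walkEnd-left x y zero    = refl
walkEnd-left x y (suc n) = walkEnd-left x y n

walkEnd-up : ∀ x y n → walkEnd (x , + y) (replicate n up) ≡ (x , + (n + y))
walkEnd-up x y zero    = refl
walkEnd-up x y (suc n) = trans (walkEnd-up x (suc y) n) (cong (λ z → x , + z) (+-suc n y))

rowDirection : Bool → Direction
rowDirection true  = right
rowDirection false = left

corner : ℕ → ℕ → Bool → ℕ
corner x width true  = x
corner x width false = width + x

module Snake (x width gap : ℕ) where

  at : Bool → ℕ → Point
  at s y = + corner x width s , + y

  -- The flag `s` is `true` at the left end, where the next row runs to the right. There are `n + 1`
  -- rows, `gap` apart, joined by climbs alternately at the right and at the left.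
  snake : ℕ → Bool → List Direction
  climb : ℕ → Bool → List Direction
  snake n s = replicate width (rowDirection s) ++ climb n (not s)
  climb zero    s = []
  climb (suc n) s = replicate gap up ++ snake n s

  rowEdges : ∀ s y {i} → i < width →
    horizontal (+ (i + x) , + y) ∈ walkEdges (at s y) (replicate width (rowDirection s))
  rowEdges true  y i< = subst (_ ∈_) (sym (walkEdges-right x (+ y) width)) (∈-applyUpTo⁺ _ i<)
  rowEdges false y i< = subst (_ ∈_) (sym (walkEdges-left x (+ y) width)) (∈-applyDownFrom⁺ _ i<)

  rowEdges⁻ : ∀ s y {e} → e ∈ walkEdges (at s y) (replicate width (rowDirection s)) →
    ∃[ z ] e ≡ horizontal (z , + y)
  rowEdges⁻ true  y e∈ with ∈-applyUpTo⁻ _ (subst (_ ∈_) (walkEdges-right x (+ y) width) e∈)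
  ... | i , _ , refl = _ , refl
  rowEdges⁻ false y e∈ with ∈-applyDownFrom⁻ _ (subst (_ ∈_) (walkEdges-left x (+ y) width) e∈)
  ... | i , _ , refl = _ , refl

  rowEnd : ∀ s y → walkEnd (at s y) (replicate width (rowDirection s)) ≡ at (not s) y
  rowEnd true  y = walkEnd-right x (+ y) width
  rowEnd false y = walkEnd-left x (+ y) width

  uniqueRow : ∀ s y → Unique (walkEdges (at s y) (replicate width (rowDirection s)))
  uniqueRow true  y = subst Unique (sym (walkEdges-right x (+ y) width))
    (Unique.applyUpTo⁺₁ _ width λ i<j _ eq → <⇒≢ i<j (+-cancelʳ-≡ x _ _ (ℤ.+-injective (cong (proj₁ ∘ lowerLeft) eq))))
  uniqueRow false y = subst Unique (sym (walkEdges-left x (+ y) width))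
    (Unique.applyDownFrom⁺₁ _ width λ j<i _ eq → <⇒≢ j<i (sym (+-cancelʳ-≡ x _ _ (ℤ.+-injective (cong (proj₁ ∘ lowerLeft) eq)))))

  climbEdges : ∀ n s y → walkEdges (at s y) (climb (suc n) s) ≡
    walkEdges (at s y) (replicate gap up) ++ walkEdges (at s (gap + y)) (snake n s)
  climbEdges n s y = trans (walkEdges-++ (at s y) (replicate gap up) _)
    (cong (λ p → walkEdges (at s y) (replicate gap up) ++ walkEdges p (snake n s))
      (walkEnd-up (+ corner x width s) y gap))

  snakeEdges : ∀ n s y → walkEdges (at s y) (snake n s) ≡
    walkEdges (at s y) (replicate width (rowDirection s)) ++ walkEdges (at (not s) y) (climb n (not s))
  snakeEdges n s y = trans (walkEdges-++ (at s y) (replicate width (rowDirection s)) _)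
    (cong (λ p → walkEdges (at s y) (replicate width (rowDirection s)) ++ walkEdges p (climb n (not s)))
      (rowEnd s y))

  next-row : ∀ i y → i * gap + (gap + y) ≡ suc i * gap + y
  next-row i y = trans (sym (+-assoc (i * gap) gap y)) (cong (_+ y) (+-comm (i * gap) gap))

  climbRun⁻ : ∀ s y {e} → e ∈ walkEdges (at s y) (replicate gap up) →
    ∃[ z ] (z < gap × e ≡ vertical (+ corner x width s , + (z + y)))
  climbRun⁻ s y e∈ = ∈-applyUpTo⁻ _ (subst (_ ∈_) (walkEdges-up _ y gap) e∈)

  -- Horizontal edges are located by the number of their row only, and vertical edges by their side.
  -- The lower bound on the height of vertical edges separates a climb from the later ones.
  SnakeEdge : ℕ → ℕ → GridEdge → Set
  SnakeEdge n y e =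
    (∃[ z ] ∃[ i ] (i ≤ n × e ≡ horizontal (z , + (i * gap + y)))) ⊎
    (∃[ z ] ∃[ s ] (y ≤ z × e ≡ vertical (+ corner x width s , + z)))

  snake⁻ : ∀ n s y {e} → e ∈ walkEdges (at s y) (snake n s) → SnakeEdge n y e
  climb⁻ : ∀ n s y {e} → e ∈ walkEdges (at s y) (climb n s) → SnakeEdge n y e

  snake⁻ n s y e∈ with ∈-++⁻ (walkEdges (at s y) (replicate width (rowDirection s))) (subst (_ ∈_) (snakeEdges n s y) e∈)
  ... | inj₂ e∈climb = climb⁻ n (not s) y e∈climb
  ... | inj₁ e∈row with rowEdges⁻ s y e∈row
  ... | z , eq = inj₁ (z , 0 , z≤n , eq)
  climb⁻ zero    s y ()
  climb⁻ (suc n) s y e∈ with ∈-++⁻ (walkEdges (at s y) (replicate gap up)) (subst (_ ∈_) (climbEdges n s y) e∈)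
  ... | inj₁ e∈run with climbRun⁻ s y e∈run
  ...   | z , _ , eq = inj₂ (z + y , s , m≤n+m y z , eq)
  climb⁻ (suc n) s y e∈ | inj₂ e∈snake with snake⁻ n s (gap + y) e∈snake
  ...   | inj₁ (z , i , i≤n , refl) = inj₁ (z , suc i , s≤s i≤n , cong (λ v → horizontal (z , + v)) (next-row i y))
  ...   | inj₂ (z , s′ , ≤z , eq)   = inj₂ (z , s′ , ≤-trans (m≤n+m y gap) ≤z , eq)

  snake⁺ : ∀ n s y {i j} → i < width → j ≤ n →
    horizontal (+ (i + x) , + (j * gap + y)) ∈ walkEdges (at s y) (snake n s)
  snake⁺ n s y i< z≤n = subst (_ ∈_) (sym (snakeEdges n s y)) (∈-++⁺ˡ (rowEdges s y i<))
  snake⁺ (suc n) s y {i} i< (s≤s {j} j≤n) = subst (_ ∈_) (sym (snakeEdges (suc n) s y))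
    (∈-++⁺ʳ (walkEdges (at s y) (replicate width (rowDirection s)))
      (subst (_ ∈_) (sym (climbEdges n (not s) y))
        (∈-++⁺ʳ (walkEdges (at (not s) y) (replicate gap up))
          (subst (λ v → horizontal (+ (i + x) , + v) ∈ walkEdges (at (not s) (gap + y)) (snake n (not s)))
            (next-row j y) (snake⁺ n (not s) (gap + y) i< j≤n)))))

  module _ (0<gap : 0 < gap) where

    -- As the gap is positive, later rows lie strictly above the present row, and later climbs begin
    -- no lower than the present climb ends.
    uniqueSnake : ∀ n s y → Unique (walkEdges (at s y) (snake n s))
    uniqueClimb : ∀ n s y → Unique (walkEdges (at s y) (climb n s))

    uniqueSnake n s y = subst Unique (sym (snakeEdges n s y))
      (Unique.++⁺ (uniqueRow s y) (uniqueClimb n (not s) y) (disjoint n))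
      where
      disjoint : ∀ n {e} → ¬ (e ∈ walkEdges (at s y) (replicate width (rowDirection s)) ×
                           e ∈ walkEdges (at (not s) y) (climb n (not s)))
      disjoint (suc n) (e∈ , e∈′) with rowEdges⁻ s y e∈ |
        ∈-++⁻ (walkEdges (at (not s) y) (replicate gap up)) (subst (_ ∈_) (climbEdges n (not s) y) e∈′)
      ... | _ , refl | inj₁ e∈run with climbRun⁻ (not s) y e∈run
      ...   | _ , _ , ()
      disjoint (suc n) (e∈ , e∈′) | _ , refl | inj₂ e∈snake with snake⁻ n (not s) (gap + y) e∈snake
      ...   | inj₂ (_ , _ , _ , ())
      ...   | inj₁ (z , i , _ , eq) = <⇒≢ y< (ℤ.+-injective (cong (proj₂ ∘ lowerLeft) eq))
        where
        y< : y < i * gap + (gap + y)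
        y< = ≤-trans (+-monoˡ-≤ y 0<gap) (m≤n+m (gap + y) (i * gap))

    uniqueClimb zero    s y = []
    uniqueClimb (suc n) s y = subst Unique (sym (climbEdges n s y))
      (Unique.++⁺ uniqueRun (uniqueSnake n s (gap + y)) disjoint)
      where
      uniqueRun : Unique (walkEdges (at s y) (replicate gap up))
      uniqueRun = subst Unique (sym (walkEdges-up _ y gap))
        (Unique.applyUpTo⁺₁ _ gap λ i<j _ eq → <⇒≢ i<j (+-cancelʳ-≡ y _ _ (ℤ.+-injective (cong (proj₂ ∘ lowerLeft) eq))))
      disjoint : ∀ {e} → ¬ (e ∈ walkEdges (at s y) (replicate gap up) ×
                           e ∈ walkEdges (at s (gap + y)) (snake n s))
      disjoint (e∈ , e∈′) with climbRun⁻ s y e∈ | snake⁻ n s (gap + y) e∈′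
      ... | _ , _ , refl   | inj₁ (_ , _ , _ , ())
      ... | z , z< , refl | inj₂ (v , _ , ≤v , eq) =
        <⇒≢ (<-≤-trans (+-monoˡ-< y z<) ≤v) (ℤ.+-injective (cong (proj₂ ∘ lowerLeft) eq))

  snakeEnd : ∀ n s y → proj₂ (walkEnd (at s y) (snake n s)) ≡ + (n * gap + y)
  snakeEnd n s y rewrite walkEnd-++ (at s y) (replicate width (rowDirection s)) (climb n (not s)) | rowEnd s y = climbEnd n
    where
    climbEnd : ∀ n → proj₂ (walkEnd (at (not s) y) (climb n (not s))) ≡ + (n * gap + y)
    climbEnd zero = refl
    climbEnd (suc n) rewrite walkEnd-++ (at (not s) y) (replicate gap up) (snake n (not s))
      | walkEnd-up (+ corner x width (not s)) y gap =
        trans (snakeEnd n (not s) (gap + y))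
          (cong +_ (next-row n y))

directionChanges-run : ∀ d n ds → directionChanges (replicate (suc n) d ++ ds) ≡ directionChanges (d ∷ ds)
directionChanges-run d zero    ds = refl
directionChanges-run d (suc n) ds with d ≟ d
... | yes _   = directionChanges-run d n ds
... | no d≢d  = contradiction refl d≢d

-- Each climb contributes a turn at its foot and one at its top. Positive width and gap keep the
-- runs between the turns nonempty.
snake-bends : ∀ {width gap} x → 0 < width → 0 < gap → ∀ n s →
  directionChanges (Snake.snake x width gap n s) ≡ n + n
snake-bends {suc w} {suc g} x _ _ n s = trans (directionChanges-run (rowDirection s) w _) (turns n s)
  where
  open Snake x (suc w) (suc g)
  turns : ∀ n s → directionChanges (rowDirection s ∷ climb n (not s)) ≡ n + n
  turns zero    s     = refl
  turns (suc n) true  = cong suc (trans (directionChanges-run up g _)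
    (trans (cong suc (trans (directionChanges-run left w _) (turns n false))) (sym (+-suc n n))))
  turns (suc n) false = cong suc (trans (directionChanges-run up g _)
    (trans (cong suc (trans (directionChanges-run right w _) (turns n true))) (sym (+-suc n n))))

snakePath : ∀ x {width gap} y n → 0 < gap → 0 < n → GridPath
snakePath x {width} {gap} y n 0<gap 0<n = record
  { start        = at true y
  ; steps        = snake n true
  ; distinctEnds = λ eq → <⇒≢ y< (ℤ.+-injective (trans (cong proj₂ eq) (snakeEnd n true y)))
  ; trail        = uniqueSnake 0<gap n true y
  }
  where
  open Snake x width gap
  y< : y < n * gap + y
  y< = +-monoˡ-≤ y (*-mono-≤ 0<n 0<gap)

-- Transposition of the grid

flipDirection : Direction → Direction
flipDirection right = up
flipDirection up    = right
flipDirection left  = down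
flipDirection down  = left

flipPoint : Point → Point
flipPoint (x , y) = y , x

flipEdge : GridEdge → GridEdge
flipEdge (horizontal p) = vertical (flipPoint p)
flipEdge (vertical p)   = horizontal (flipPoint p)

flipEdge-involutive : ∀ e → flipEdge (flipEdge e) ≡ e
flipEdge-involutive (horizontal p) = refl
flipEdge-involutive (vertical p)   = refl

move-flip : ∀ d p → move (flipDirection d) (flipPoint p) ≡ flipPoint (move d p)
move-flip right p = refl
move-flip left  p = refl
move-flip up    p = refl
move-flip down  p = refl

edgeAt-flip : ∀ d p → edgeAt (flipDirection d) (flipPoint p) ≡ flipEdge (edgeAt d p)
edgeAt-flip right p = refl
edgeAt-flip left  p = refl
edgeAt-flip up    p = refl
edgeAt-flip down  p = refl

walkEdges-flip : ∀ p ds → walkEdges (flipPoint p) (map flipDirection ds) ≡ map flipEdge (walkEdges p ds)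
walkEdges-flip p []       = refl
walkEdges-flip p (d ∷ ds) rewrite move-flip d p = cong₂ _∷_ (edgeAt-flip d p) (walkEdges-flip (move d p) ds)

walkEnd-flip : ∀ p ds → walkEnd (flipPoint p) (map flipDirection ds) ≡ flipPoint (walkEnd p ds)
walkEnd-flip p []       = refl
walkEnd-flip p (d ∷ ds) rewrite move-flip d p = walkEnd-flip (move d p) ds

flip-does : ∀ d e → does (flipDirection d ≟ flipDirection e) ≡ does (d ≟ e)
flip-does right right = refl
flip-does right left  = refl
flip-does right up    = refl
flip-does right down  = refl
flip-does left  right = refl
flip-does left  left  = refl
flip-does left  up    = refl
flip-does left  down  = refl
flip-does up    right = refl
flip-does up    left  = refl
flip-does up    up    = refl
flip-does up    down  = refl
flip-does down  right = refl
flip-does down  left  = refl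
flip-does down  up    = refl
flip-does down  down  = refl

directionChanges-flip : ∀ ds → directionChanges (map flipDirection ds) ≡ directionChanges ds
directionChanges-flip []           = refl
directionChanges-flip (d ∷ [])     = refl
directionChanges-flip (d ∷ e ∷ ds) = cong₂ (λ b n → if b then n else suc n)
  (flip-does d e) (directionChanges-flip (e ∷ ds))

flipPath : GridPath → GridPath
flipPath P = record
  { start        = flipPoint (start P)
  ; steps        = map flipDirection (steps P)
  ; distinctEnds = λ eq → distinctEnds P (cong flipPoint (trans eq (walkEnd-flip (start P) (steps P))))
  ; trail        = subst Unique (sym (walkEdges-flip (start P) (steps P)))
      (Unique.map⁺ (λ {e} {f} eq → trans (sym (flipEdge-involutive e)) (trans (cong flipEdge eq) (flipEdge-involutive f)))
        (trail P))
  }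

flipPath⁺ : ∀ P {e} → e ∈ edges P → flipEdge e ∈ edges (flipPath P)
flipPath⁺ P e∈ = subst (_ ∈_) (sym (walkEdges-flip (start P) (steps P))) (∈-map⁺ flipEdge e∈)

flipPath⁻ : ∀ P {e} → e ∈ edges (flipPath P) → flipEdge e ∈ edges P
flipPath⁻ P e∈ with ∈-map⁻ flipEdge (subst (_ ∈_) (walkEdges-flip (start P) (steps P)) e∈)
... | f , f∈ , refl = subst (_∈ edges P) (sym (flipEdge-involutive f)) f∈

-- Staircases with unit steps

zigzag : ℕ → List Direction
zigzag zero          = []
zigzag (suc zero)    = right ∷ []
zigzag (suc (suc n)) = right ∷ up ∷ zigzag n

zigzag-ascending : ∀ n → All Ascending (zigzag n)
zigzag-ascending zero          = []
zigzag-ascending (suc zero)    = right ∷ []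
zigzag-ascending (suc (suc n)) = right ∷ up ∷ zigzag-ascending n

zigzag-bends : ∀ n → directionChanges (zigzag (suc n)) ≡ n
zigzag-bends zero          = refl
zigzag-bends (suc zero)    = refl
zigzag-bends (suc (suc n)) = cong suc (trans (after-up n) (cong suc (zigzag-bends n)))
  where
  after-up : ∀ n → directionChanges (up ∷ zigzag (suc n)) ≡ suc (directionChanges (zigzag (suc n)))
  after-up zero    = refl
  after-up (suc n) = refl

-- With the edges numbered from 0, the horizontal ones have the even numbers `m + m` and the
-- vertical ones the odd numbers `suc (m + m)`.
zigzag⁺-horizontal : ∀ n x y m → m + m < n →
  horizontal (+ (m + x) , + (m + y)) ∈ walkEdges (+ x , + y) (zigzag n)
zigzag⁺-horizontal (suc zero)    x y zero    _ = here refl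
zigzag⁺-horizontal (suc (suc n)) x y zero    _ = here refl
zigzag⁺-horizontal (suc zero)    x y (suc m) (s≤s ())
zigzag⁺-horizontal (suc (suc n)) x y (suc m) (s≤s m+m<) =
  subst₂ (λ u v → horizontal (+ u , + v) ∈ walkEdges (+ x , + y) (zigzag (suc (suc n)))) (+-suc m x) (+-suc m y)
    (there (there (zigzag⁺-horizontal n (suc x) (suc y) m (s≤s⁻¹ (subst (_≤ suc n) (cong suc (+-suc m m)) m+m<)))))

zigzag⁺-vertical : ∀ n x y m → suc (m + m) < n →
  vertical (+ (suc m + x) , + (m + y)) ∈ walkEdges (+ x , + y) (zigzag n)
zigzag⁺-vertical (suc zero)    x y m       (s≤s ())
zigzag⁺-vertical (suc (suc n)) x y zero    _ = there (here refl)
zigzag⁺-vertical (suc (suc n)) x y (suc m) (s≤s (s≤s m+m<)) =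
  subst₂ (λ u v → vertical (+ u , + v) ∈ walkEdges (+ x , + y) (zigzag (suc (suc n)))) (cong suc (+-suc m x)) (+-suc m y)
    (there (there (zigzag⁺-vertical n (suc x) (suc y) m (subst (_≤ n) (cong suc (+-suc m m)) m+m<))))

ZigzagEdge : ℕ → ℕ → ℕ → GridEdge → Set
ZigzagEdge n x y e =
  (∃[ m ] (m + m < n × e ≡ horizontal (+ (m + x) , + (m + y)))) ⊎
  (∃[ m ] (suc (m + m) < n × e ≡ vertical (+ (suc m + x) , + (m + y))))

zigzag⁻ : ∀ n x y {e} → e ∈ walkEdges (+ x , + y) (zigzag n) → ZigzagEdge n x y e
zigzag⁻ (suc zero)    x y (here refl)         = inj₁ (0 , s≤s z≤n , refl)
zigzag⁻ (suc (suc n)) x y (here refl)         = inj₁ (0 , s≤s z≤n , refl)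
zigzag⁻ (suc (suc n)) x y (there (here refl)) = inj₂ (0 , s≤s (s≤s z≤n) , refl)
zigzag⁻ (suc (suc n)) x y (there (there e∈)) with zigzag⁻ n (suc x) (suc y) e∈
... | inj₁ (m , m+m< , refl) = inj₁ (suc m , s≤s (subst (_≤ suc n) (sym (cong suc (+-suc m m))) (s≤s m+m<)) ,
        cong₂ (λ u v → horizontal (+ u , + v)) (+-suc m x) (+-suc m y))
... | inj₂ (m , m+m< , refl) = inj₂ (suc m , s≤s (s≤s (subst (_≤ n) (sym (cong suc (+-suc m m))) m+m<)) ,
        cong₂ (λ u v → vertical (+ u , + v)) (cong suc (+-suc m x)) (+-suc m y))

ascending-unique : ∀ p {ds} → All Ascending ds → Unique (walkEdges p ds)
ascending-unique p []         = []
ascending-unique p {d ∷ ds} (ad ∷ ads) =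
  All.tabulate (λ f∈ eq → not-below ad (subst (below (move d p)) (sym eq) (start-below (move d p) ads f∈))) ∷
  ascending-unique (move d p) ads
  where
  not-below : ∀ {d} → Ascending d → ∀ {p} → ¬ below (move d p) (edgeAt d p)
  not-below right b = suc≰ _ (proj₁ b)
  not-below up    b = suc≰ _ (proj₂ b)

walkEnd-ascending : ∀ p {ds} → All Ascending ds → proj₁ p ℤ.≤ proj₁ (walkEnd p ds)
walkEnd-ascending p []            = ℤ.≤-refl
walkEnd-ascending p (right ∷ ads) = ℤ.≤-trans (ℤ.i≤suc[i] _) (walkEnd-ascending _ ads)
walkEnd-ascending p (up ∷ ads)    = walkEnd-ascending _ ads

zigzagPath : ℕ → ℕ → ℕ → GridPath
zigzagPath n x y = record
  { start        = + x , + y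
  ; steps        = zigzag (suc n)
  ; distinctEnds = proper n
  ; trail        = ascending-unique _ (zigzag-ascending (suc n))
  }
  where
  proper : ∀ n → (+ x , + y) ≢ walkEnd (+ x , + y) (zigzag (suc n))
  proper zero    ()
  proper (suc n) eq = suc≰ (+ x) (subst (+ suc x ℤ.≤_) (sym (cong proj₁ eq)) (walkEnd-ascending _ (zigzag-ascending n)))

-- The separating graph

length-cartesianProduct : ∀ {X Y : Set} (xs : List X) (ys : List Y) →
  length (cartesianProduct xs ys) ≡ length xs * length ys
length-cartesianProduct []       ys = refl
length-cartesianProduct (x ∷ xs) ys =
  trans (length-++ (map (x ,_) ys)) (cong₂ _+_ (length-map (x ,_) ys) (length-cartesianProduct xs ys))

shareEdge? : ∀ P Q → Dec (ShareEdge P Q)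
shareEdge? P Q = map′ (λ any → find any) (λ (_ , e∈P , e∈Q) → lose e∈P e∈Q)
  (any? (λ e → e ∈? edges Q) (edges P))

shareEdge-sym : ∀ P Q → ShareEdge P Q → ShareEdge Q P
shareEdge-sym _ _ (e , e∈P , e∈Q) = e , e∈Q , e∈P

-- Intersection graphs of paths and their further representations

module IntersectionGraph {X : Set} {N : ℕ} (numbering : Fin N ↔ X) (P : X → GridPath) where
  open Inverse numbering using (to; from; strictlyInverseˡ)

  graph : Graph
  graph = record
    { order  = N
    ; Adj    = λ v w → v ≢ w × ShareEdge (P (to v)) (P (to w))
    ; sym    = λ {v} {w} (v≢w , share) → ≢-sym v≢w , shareEdge-sym (P (to v)) (P (to w)) share
    ; irrefl = λ v≡w (v≢w , _) → v≢w v≡w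
    ; adj?   = λ v w → ¬? (v Fin.≟ w) ×-dec shareEdge? (P (to v)) (P (to w))
    }

  graph∈B : ∀ {k} → (∀ x → bends (P x) ≤ k) → B k graph
  graph∈B bound = record
    { path      = λ v → P (to v)
    ; adj⇔share = λ v w v≢w → mk⇔ proj₂ (v≢w ,_)
    } , λ v → bound (to v)

  module Representation (R : EPGRepresentation graph) where
    Q : X → GridPath
    Q x = EPGRepresentation.path R (from x)

    from-injective : ∀ {x y} → from x ≡ from y → x ≡ y
    from-injective {x} {y} eq = trans (sym (strictlyInverseˡ x)) (trans (cong to eq) (strictlyInverseˡ y))

    share⁺ : ∀ {x y} → x ≢ y → ShareEdge (P x) (P y) → ShareEdge (Q x) (Q y)
    share⁺ {x} {y} x≢y share = Equivalence.to (EPGRepresentation.adj⇔share R (from x) (from y) v≢w)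
      (v≢w , subst₂ (λ x y → ShareEdge (P x) (P y)) (sym (strictlyInverseˡ x)) (sym (strictlyInverseˡ y)) share)
      where
      v≢w : from x ≢ from y
      v≢w eq = x≢y (from-injective eq)

    share⁻ : ∀ {x y} → x ≢ y → ShareEdge (Q x) (Q y) → ShareEdge (P x) (P y)
    share⁻ {x} {y} x≢y share =
      subst₂ (λ x y → ShareEdge (P x) (P y)) (strictlyInverseˡ x) (strictlyInverseˡ y)
        (proj₂ (Equivalence.from (EPGRepresentation.adj⇔share R (from x) (from y)
          (λ eq → x≢y (from-injective eq))) share))

    -- An edge shared in the new representation would make two distinct vertices adjacent, so their
    -- original paths would share an edge as well. In this way the disjointness of spines and of
    -- bridges carries over to an arbitrary representation.
    disjoint : ∀ {x y} → (∀ {e} → e ∈ edges (P x) → e ∈ edges (P y) → x ≡ y) →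
      ∀ {e} → e ∈ edges (Q x) → e ∈ edges (Q y) → x ≡ y
    disjoint {x} {y} disjointP e∈ e∈′ with from x Fin.≟ from y
    ... | yes eq = from-injective eq
    ... | no neq with share⁻ (λ x≡y → neq (cong from x≡y)) (_ , e∈ , e∈′)
    ... | _ , f∈ , f∈′ = disjointP f∈ f∈′

-- With the crossing area at positions `m` to `m + w - 1`, a left corner `x` lies before it and a
-- right corner `m + w + x` behind it.
corner-outside : ∀ {x z m w} s → x < m → z < w → corner x (m + w) s ≢ m + z
corner-outside {z = z} {m} true  x<m z<w eq = <⇒≱ x<m (subst (m ≤_) (sym eq) (m≤m+n m z))
corner-outside {x} {z} {m} {w} false x<m z<w eq = <⇒≱ z<w (≤-trans (m≤m+n w x)
  (≤-reflexive (+-cancelˡ-≡ m _ _ (trans (sym (+-assoc m w x)) eq))))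

corner-injective : ∀ {x y m w} s s′ → x < m → y < m → corner x (m + w) s ≡ corner y (m + w) s′ → x ≡ y
corner-injective true  true  _ _ eq = eq
corner-injective {m = m} {w} true  false x<m _ eq =
  contradiction (≤-trans (≤-trans (m≤m+n m w) (m≤m+n _ _)) (≤-reflexive (sym eq))) (<⇒≱ x<m)
corner-injective {m = m} {w} false true  _ y<m eq =
  contradiction (≤-trans (≤-trans (m≤m+n m w) (m≤m+n _ _)) (≤-reflexive eq)) (<⇒≱ y<m)
corner-injective {m = m} {w} false false _ _ eq = +-cancelˡ-≡ (m + w) _ _ eq

row-injective : ∀ {i j} → row (+ i) ≡ row (+ j) → i ≡ j
row-injective refl = refl

column-injective : ∀ {i j} → column (+ i) ≡ column (+ j) → i ≡ j
column-injective refl = refl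

-- The rows span the positions from `x` to `x + m + w`. Since `x < m`, they run across the whole
-- crossing area, whose position `m + z` is number `m + z - x` in the row.
snakePath⁺ : ∀ {x m w y gap n z j} (0<gap : 0 < gap) (0<n : 0 < n) → x < m → z < w → j ≤ n →
  horizontal (+ (m + z) , + (j * gap + y)) ∈ edges (snakePath x {m + w} {gap} y n 0<gap 0<n)
snakePath⁺ {x} {m} {w} {y} {gap} {n} {z} {j} _ _ x<m z<w j≤n =
  subst (λ u → horizontal (+ u , + (j * gap + y)) ∈ walkEdges (+ x , + y) (Snake.snake x (m + w) gap n true)) i+x≡
    (Snake.snake⁺ x (m + w) gap n true y (≤-<-trans (m∸n≤m (m + z) x) (+-monoʳ-< m z<w)) j≤n)
  where
  i+x≡ : (m + z) ∸ x + x ≡ m + z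
  i+x≡ = m∸n+n≡m (≤-trans (<⇒≤ x<m) (m≤m+n m z))

-- Here `k` stands for the number of events per bridge, twice the number of bends. Each of the `D`
-- bridges lacks at least 8 events, and together the excess cannot supply `D * 8`.
count-contradiction : ∀ {D Q k ℓ m} → ℓ + 8 ≤ k → suc ℓ ≤ m → Q * m < D * 8 →
  ¬ D * k ≤ D * ℓ + Q * suc ℓ
count-contradiction {D} {Q} {k} {ℓ} {m} ℓ+8≤k ℓ<m Qm<8D le = <⇒≱ Qm<8D (≤-trans
  (+-cancelˡ-≤ (D * ℓ) _ _ (≤-trans (≤-reflexive (sym (*-distribˡ-+ D ℓ 8))) (≤-trans (*-monoʳ-≤ D ℓ+8≤k) le)))
  (*-monoʳ-≤ Q ℓ<m))

-- The grid of spines and bridges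

module Construction (n u c′ g : ℕ) (0<n : 0 < n) (n≤u : n ≤ u) (u≤t : u ≤ suc n) (t≤c : suc n ≤ suc c′) where

  -- The bend number is `n + u`. A bridge has `t` horizontal edges, one for each across path of its
  -- block, and `u` vertical edges, `n + u + 1` in total. A spine with `t` long pieces has `n + n`
  -- bends.
  t c a : ℕ
  t = suc n
  c = suc c′
  a = g * t

  -- Across paths come in g blocks of t.  The crossing area has the columns a ≤ x < a + t c and the
  -- rows c ≤ y < c + a t; all connecting pieces of the spines run outside of it.  Row (γ , τ , α) is
  -- the τ-th row of across path (γ , α), so the t consecutive rows of (γ , τ) belong to different paths
  -- of block γ.  Column (τ , v) is the τ-th column of along path v.
  Across Along Bridge Spine : Set
  Across = Fin g × Fin t
  Along  = Fin c
  Bridge = Fin (t * c′) × (Fin g × Fin t)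
  Spine  = Across ⊎ Along

  0<t : 0 < t
  0<t = s≤s z≤n

  0<c : 0 < c
  0<c = s≤s z≤n

  rowOf : Fin g → Fin t → Fin t → ℕ
  rowOf γ τ α = c + toℕ (combine (combine γ τ) α)

  columnOf : Fin t → Fin c → ℕ
  columnOf τ v = a + toℕ (combine τ v)

  spine : Spine → GridPath
  spine (inj₁ (γ , α)) = snakePath (toℕ (combine γ α)) {a + t * c} {t} (c + (t * (t * toℕ γ) + toℕ α)) n 0<t 0<n
  spine (inj₂ v)       = flipPath (snakePath (toℕ v) {c + a * t} {c} (a + toℕ v) n 0<c 0<n)

  bridge : Bridge → GridPath
  bridge (x , γ , τ) = zigzagPath (n + u) (a + toℕ x) (c + t * toℕ (combine γ τ))

  rowOf-snake : ∀ γ τ α → toℕ τ * t + (c + (t * (t * toℕ γ) + toℕ α)) ≡ rowOf γ τ α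
  rowOf-snake γ τ α = begin
    toℕ τ * t + (c + (t * (t * toℕ γ) + toℕ α)) ≡⟨ rearrange (toℕ τ) t c (t * toℕ γ) (toℕ α) ⟩
    c + (t * (t * toℕ γ + toℕ τ) + toℕ α)       ≡⟨ cong (λ q → c + (t * q + toℕ α)) (toℕ-combine γ τ) ⟨
    c + (t * toℕ (combine γ τ) + toℕ α)         ≡⟨ cong (λ z → c + z) (toℕ-combine (combine γ τ) α) ⟨
    rowOf γ τ α                                 ∎
    where
    open ≡-Reasoning
    rearrange : ∀ i t c q j → i * t + (c + (t * q + j)) ≡ c + (t * (q + i) + j)
    rearrange = solve-∀

  rowOf-bridge : ∀ γ τ m → toℕ m + (c + t * toℕ (combine γ τ)) ≡ rowOf γ τ m
  rowOf-bridge γ τ m = trans (rearrange (toℕ m) c (t * toℕ (combine γ τ)))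
    (cong (λ z → c + z) (sym (toℕ-combine (combine γ τ) m)))
    where
    rearrange : ∀ i j q → i + (j + q) ≡ j + (q + i)
    rearrange = solve-∀

  columnOf-snake : ∀ τ v → toℕ τ * c + (a + toℕ v) ≡ columnOf τ v
  columnOf-snake τ v = trans (rearrange (toℕ τ) c a (toℕ v)) (cong (λ z → a + z) (sym (toℕ-combine τ v)))
    where
    rearrange : ∀ i c a j → i * c + (a + j) ≡ a + (c * i + j)
    rearrange = solve-∀

  rowOf-injective : ∀ γ τ α γ′ τ′ α′ → rowOf γ τ α ≡ rowOf γ′ τ′ α′ → (γ ≡ γ′ × τ ≡ τ′) × α ≡ α′
  rowOf-injective γ τ α γ′ τ′ α′ eq
    with combine-injective (combine γ τ) α (combine γ′ τ′) α′ (toℕ-injective (+-cancelˡ-≡ c _ _ eq))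
  ... | eq′ , α≡ = combine-injective γ τ γ′ τ′ eq′ , α≡

  columnOf-injective : ∀ τ v τ′ v′ → columnOf τ v ≡ columnOf τ′ v′ → v ≡ v′
  columnOf-injective τ v τ′ v′ eq =
    proj₂ (combine-injective τ v τ′ v′ (toℕ-injective (+-cancelˡ-≡ a _ _ eq)))

  across-line : ∀ γ α {e} → e ∈ edges (spine (inj₁ (γ , α))) →
    (∃[ τ ] lineOf e ≡ row (+ rowOf γ τ α)) ⊎
    (∃[ s ] lineOf e ≡ column (+ corner (toℕ (combine γ α)) (a + t * c) s))
  across-line γ α e∈ with Snake.snake⁻ (toℕ (combine γ α)) (a + t * c) t n true _ e∈
  ... | inj₂ (_ , s , _ , refl)   = inj₂ (s , refl)
  ... | inj₁ (_ , i , i≤n , refl) = inj₁ (fromℕ< (s≤s i≤n) , cong (λ r → row (+ r))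
    (trans (cong (λ i → i * t + _) (sym (toℕ-fromℕ< (s≤s i≤n)))) (rowOf-snake γ (fromℕ< (s≤s i≤n)) α)))

  along-line : ∀ v {e} → e ∈ edges (spine (inj₂ v)) →
    (∃[ τ ] lineOf e ≡ column (+ columnOf τ v)) ⊎
    (∃[ s ] lineOf e ≡ row (+ corner (toℕ v) (c + a * t) s))
  along-line v {e} e∈ with flipEdge-involutive e | Snake.snake⁻ (toℕ v) (c + a * t) c n true _
    (flipPath⁻ (snakePath (toℕ v) {c + a * t} {c} (a + toℕ v) n 0<c 0<n) e∈)
  ... | flipped | inj₂ (_ , s , _ , eq)   = inj₂ (s , cong lineOf (trans (sym flipped) (cong flipEdge eq)))
  ... | flipped | inj₁ (_ , i , i≤n , eq) = inj₁ (fromℕ< (s≤s i≤n) ,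
    trans (cong lineOf (trans (sym flipped) (cong flipEdge eq))) (cong (λ r → column (+ r))
      (trans (cong (λ i → i * c + _) (sym (toℕ-fromℕ< (s≤s i≤n)))) (columnOf-snake (fromℕ< (s≤s i≤n)) v))))

  -- Because `u ≤ t`, the sum `n + u` is at most `2 * n + 1`, which is less than `t + t`.
  half-bound : ∀ {m} → m + m ≤ n + u → m < t
  half-bound {m} m+m≤ with m ℕ.≤? n
  ... | yes m≤n = s≤s m≤n
  ... | no  m≰n = contradiction (≤-trans m+m≤ (+-monoʳ-≤ n u≤t)) (<⇒≱ (+-mono-≤ (≰⇒> m≰n) (≰⇒> m≰n)))

  bridge-edge : ∀ x γ τ {e} → e ∈ edges (bridge (x , γ , τ)) →
    (∃[ m ] e ≡ horizontal (+ (toℕ m + (a + toℕ x)) , + rowOf γ τ m)) ⊎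
    (∃[ m ] e ≡ vertical (+ (suc (toℕ m) + (a + toℕ x)) , + rowOf γ τ m))
  bridge-edge x γ τ e∈ with zigzag⁻ (suc (n + u)) (a + toℕ x) (c + t * toℕ (combine γ τ)) e∈
  ... | inj₁ (m , m+m< , refl) = inj₁ (fromℕ< m<t , cong₂ (λ i j → horizontal (+ i , + j))
    (cong (_+ (a + toℕ x)) (sym (toℕ-fromℕ< m<t)))
    (trans (cong (_+ (c + t * toℕ (combine γ τ))) (sym (toℕ-fromℕ< m<t))) (rowOf-bridge γ τ (fromℕ< m<t))))
    where
    m<t : m < t
    m<t = half-bound (s≤s⁻¹ m+m<)
  ... | inj₂ (m , m+m< , refl) = inj₂ (fromℕ< m<t , cong₂ (λ i j → vertical (+ i , + j))
    (cong (λ m → suc m + (a + toℕ x)) (sym (toℕ-fromℕ< m<t)))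
    (trans (cong (_+ (c + t * toℕ (combine γ τ))) (sym (toℕ-fromℕ< m<t))) (rowOf-bridge γ τ (fromℕ< m<t))))
    where
    m<t : m < t
    m<t = half-bound (≤-trans (n≤1+n _) (s≤s⁻¹ m+m<))

  -- Bridges start only in the first `t * c′ = t * c - t` columns of the crossing area, which leaves
  -- room for the at most `t` columns that they advance.
  x+m<tc : ∀ (x : Fin (t * c′)) {m} → m ≤ t → toℕ x + m < t * c
  x+m<tc x {m} m≤t = subst (toℕ x + m <_) (trans (+-comm (t * c′) t) (sym (*-suc t c′)))
    (+-mono-<-≤ (toℕ<n x) m≤t)

  across≠along : ∀ h v {e} → e ∈ edges (spine (inj₁ h)) → ¬ e ∈ edges (spine (inj₂ v))
  across≠along (γ , α) v e∈ e∈′ with across-line γ α e∈ | along-line v e∈′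
  ... | inj₁ (τ , eq) | inj₂ (s , eq′) = corner-outside s (toℕ<n v) (toℕ<n _) (row-injective (trans (sym eq′) eq))
  ... | inj₂ (s , eq) | inj₁ (τ , eq′) = corner-outside s (toℕ<n (combine γ α)) (toℕ<n _)
                                           (column-injective (trans (sym eq) eq′))
  ... | inj₁ (_ , eq) | inj₁ (_ , eq′) with trans (sym eq) eq′
  ... | ()
  across≠along (γ , α) v e∈ e∈′ | inj₂ (_ , eq) | inj₂ (_ , eq′) with trans (sym eq) eq′
  ... | ()

  -- No grid line carries edges of two spines. The long pieces have lines of their own inside the
  -- crossing area, and the connecting pieces have lines of their own outside of it, so comparing
  -- lines suffices.
  disjointSpine : ∀ {i i′ e} → e ∈ edges (spine i) → e ∈ edges (spine i′) → i ≡ i′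
  disjointSpine {inj₁ (γ , α)} {inj₁ (γ′ , α′)} e∈ e∈′ with across-line γ α e∈ | across-line γ′ α′ e∈′
  ... | inj₁ (τ , eq) | inj₁ (τ′ , eq′) with rowOf-injective γ τ α γ′ τ′ α′ (row-injective (trans (sym eq) eq′))
  ...   | (refl , _) , refl = refl
  disjointSpine {inj₁ (γ , α)} {inj₁ (γ′ , α′)} e∈ e∈′ | inj₂ (s , eq) | inj₂ (s′ , eq′)
    with combine-injective γ α γ′ α′ (toℕ-injective (corner-injective s s′ (toℕ<n _) (toℕ<n _)
           (column-injective (trans (sym eq) eq′))))
  ... | refl , refl = refl
  disjointSpine {inj₁ _} {inj₁ _} e∈ e∈′ | inj₁ (_ , eq) | inj₂ (_ , eq′) with trans (sym eq) eq′
  ... | ()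
  disjointSpine {inj₁ _} {inj₁ _} e∈ e∈′ | inj₂ (_ , eq) | inj₁ (_ , eq′) with trans (sym eq) eq′
  ... | ()
  disjointSpine {inj₂ v} {inj₂ v′} e∈ e∈′ with along-line v e∈ | along-line v′ e∈′
  ... | inj₁ (τ , eq) | inj₁ (τ′ , eq′) = cong inj₂ (columnOf-injective τ v τ′ v′ (column-injective (trans (sym eq) eq′)))
  ... | inj₂ (s , eq) | inj₂ (s′ , eq′) = cong inj₂ (toℕ-injective
          (corner-injective s s′ (toℕ<n v) (toℕ<n v′) (row-injective (trans (sym eq) eq′))))
  ... | inj₁ (_ , eq) | inj₂ (_ , eq′) with trans (sym eq) eq′
  ... | ()
  disjointSpine {inj₂ _} {inj₂ _} e∈ e∈′ | inj₂ (_ , eq) | inj₁ (_ , eq′) with trans (sym eq) eq′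
  ... | ()
  disjointSpine {inj₁ h} {inj₂ v} e∈ e∈′ = ⊥-elim (across≠along h v e∈ e∈′)
  disjointSpine {inj₂ v} {inj₁ h} e∈ e∈′ = ⊥-elim (across≠along h v e∈′ e∈)

  -- The row of an edge gives `γ`, `τ` and the number of the edge on the staircase; its column then
  -- gives the starting column.
  disjointBridge : ∀ {j j′ e} → e ∈ edges (bridge j) → e ∈ edges (bridge j′) → j ≡ j′
  disjointBridge {x , γ , τ} {x′ , γ′ , τ′} e∈ e∈′ with bridge-edge x γ τ e∈ | bridge-edge x′ γ′ τ′ e∈′
  ... | inj₁ (m , refl) | inj₁ (m′ , eq)
    with rowOf-injective γ τ m γ′ τ′ m′ (ℤ.+-injective (cong (proj₂ ∘ lowerLeft) eq))
  ... | (refl , refl) , refl = cong (_, γ , τ) (toℕ-injective (+-cancelˡ-≡ a _ _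
          (+-cancelˡ-≡ (toℕ m) _ _ (ℤ.+-injective (cong (proj₁ ∘ lowerLeft) eq)))))
  disjointBridge {x , γ , τ} {x′ , γ′ , τ′} e∈ e∈′ | inj₂ (m , refl) | inj₂ (m′ , eq)
    with rowOf-injective γ τ m γ′ τ′ m′ (ℤ.+-injective (cong (proj₂ ∘ lowerLeft) eq))
  ... | (refl , refl) , refl = cong (_, γ , τ) (toℕ-injective (+-cancelˡ-≡ a _ _
          (+-cancelˡ-≡ (suc (toℕ m)) _ _ (ℤ.+-injective (cong (proj₁ ∘ lowerLeft) eq)))))
  disjointBridge e∈ e∈′ | inj₁ (m , refl) | inj₂ (m′ , ())
  disjointBridge e∈ e∈′ | inj₂ (m , refl) | inj₁ (m′ , ())

  -- The horizontal edges of a bridge lie in rows of its own block, and its vertical edges stay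
  -- inside the crossing area, away from the connecting columns of across paths.
  across-block : ∀ {γ α x γ′ τ} → ShareEdge (spine (inj₁ (γ , α))) (bridge (x , γ′ , τ)) → γ ≡ γ′
  across-block {γ} {α} {x} {γ′} {τ} (e , e∈ , e∈′) with across-line γ α e∈ | bridge-edge x γ′ τ e∈′
  ... | inj₁ (τ₁ , eq) | inj₁ (m , refl) =
        sym (proj₁ (proj₁ (rowOf-injective γ′ τ m γ τ₁ α (row-injective eq))))
  ... | inj₁ (_ , ())  | inj₂ (m , refl)
  ... | inj₂ (_ , ())  | inj₁ (m , refl)
  ... | inj₂ (s , eq)  | inj₂ (m , refl) = ⊥-elim (corner-outside s (toℕ<n (combine γ α)) (x+m<tc x (toℕ<n m))
        (trans (sym (column-injective eq)) (rearrange (toℕ m) a (toℕ x))))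
    where
    rearrange : ∀ m a x → suc m + (a + x) ≡ a + (x + suc m)
    rearrange = solve-∀

  meets-across : ∀ x γ τ α → ShareEdge (spine (inj₁ (γ , α))) (bridge (x , γ , τ))
  meets-across x γ τ α = horizontal (+ (a + (toℕ x + toℕ α)) , + rowOf γ τ α) ,
    subst (λ r → horizontal (+ (a + (toℕ x + toℕ α)) , + r) ∈ edges (spine (inj₁ (γ , α)))) (rowOf-snake γ τ α)
      (snakePath⁺ 0<t 0<n (toℕ<n (combine γ α)) (x+m<tc x (<⇒≤ (toℕ<n α))) (s≤s⁻¹ (toℕ<n τ))) ,
    subst₂ (λ i j → horizontal (+ i , + j) ∈ edges (bridge (x , γ , τ)))
      (rearrange (toℕ α) a (toℕ x)) (rowOf-bridge γ τ α)
      (zigzag⁺-horizontal (suc (n + u)) (a + toℕ x) _ (toℕ α)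
        (s≤s (+-mono-≤ (s≤s⁻¹ (toℕ<n α)) (≤-trans (s≤s⁻¹ (toℕ<n α)) n≤u))))
    where
    rearrange : ∀ m a x → m + (a + x) ≡ a + (x + m)
    rearrange = solve-∀

  m<u⇒m<t : ∀ (m : Fin u) → toℕ m < t
  m<u⇒m<t m = <-≤-trans (toℕ<n m) u≤t

  -- Vertical edge number `m` comes after `m + 1` horizontal steps, hence the offset `suc`. Division
  -- of the column number by `c` then gives the along path as remainder and its column as quotient.
  crossing : Fin (t * c′) → Fin u → Fin (t * c)
  crossing x m = fromℕ< (x+m<tc x (m<u⇒m<t m))

  crossed : Fin (t * c′) → Fin u → Fin t × Along
  crossed x m = remQuot c (crossing x m)

  toℕ-crossed : ∀ x m → toℕ (combine (proj₁ (crossed x m)) (proj₂ (crossed x m))) ≡ toℕ x + suc (toℕ m)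
  toℕ-crossed x m = trans (cong toℕ (combine-remQuot {t} c (crossing x m))) (toℕ-fromℕ< (x+m<tc x (m<u⇒m<t m)))

  meets-along : ∀ x γ τ m → ShareEdge (spine (inj₂ (proj₂ (crossed x m)))) (bridge (x , γ , τ))
  meets-along x γ τ m = vertical (+ (a + toℕ (combine σ v)) , + rowOf γ τ m′) ,
    flipPath⁺ V (subst (λ r → horizontal (+ rowOf γ τ m′ , + r) ∈ edges V) (columnOf-snake σ v)
      (snakePath⁺ 0<c 0<n (toℕ<n v) (toℕ<n (combine (combine γ τ) m′)) (s≤s⁻¹ (toℕ<n σ)))) ,
    subst₂ (λ i j → vertical (+ i , + j) ∈ edges (bridge (x , γ , τ)))
      (trans (rearrange (toℕ m) a (toℕ x)) (cong (λ z → a + z) (sym (toℕ-crossed x m))))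
      (trans (cong (_+ (c + t * toℕ (combine γ τ))) (sym (toℕ-fromℕ< (m<u⇒m<t m)))) (rowOf-bridge γ τ m′))
      (zigzag⁺-vertical (suc (n + u)) (a + toℕ x) _ (toℕ m)
        (s≤s (+-mono-≤-< (s≤s⁻¹ (m<u⇒m<t m)) (toℕ<n m))))
    where
    σ  = proj₁ (crossed x m)
    v  = proj₂ (crossed x m)
    m′ = fromℕ< (m<u⇒m<t m)
    V  = snakePath (toℕ v) {c + a * t} {c} (a + toℕ v) n 0<c 0<n
    rearrange : ∀ m a x → suc m + (a + x) ≡ a + (x + suc m)
    rearrange = solve-∀

  -- The long columns of one along path are `c` apart, while the `u ≤ t ≤ c` vertical edges of a
  -- bridge use consecutive columns. So they meet `u` different along paths.
  crossed-injective : ∀ x {m m′} → proj₂ (crossed x m) ≡ proj₂ (crossed x m′) → m ≡ m′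
  crossed-injective x {m} {m′} v≡v′ = toℕ-injective (periods (<-cmp (toℕ σ) (toℕ σ′)))
    where
    σ  = proj₁ (crossed x m)
    σ′ = proj₁ (crossed x m′)
    v  = toℕ (proj₂ (crossed x m))

    position : ∀ m {v′} → v ≡ v′ → toℕ (proj₂ (crossed x m)) ≡ v′ → c * toℕ (proj₁ (crossed x m)) + v ≡ toℕ x + suc (toℕ m)
    position m refl eq = trans (cong (λ z → c * toℕ (proj₁ (crossed x m)) + z) (sym eq))
      (trans (sym (toℕ-combine (proj₁ (crossed x m)) (proj₂ (crossed x m)))) (toℕ-crossed x m))

    p : c * toℕ σ + v ≡ toℕ x + suc (toℕ m)
    p = position m refl refl

    p′ : c * toℕ σ′ + v ≡ toℕ x + suc (toℕ m′)
    p′ = position m′ refl (cong toℕ (sym v≡v′))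

    -- Two different columns of the same along path differ by at least `c`, so the later edge would
    -- have a number of at least `c`.
    too-far : ∀ {i j k l : ℕ} → i < j → c * i + v ≡ toℕ x + suc k → c * j + v ≡ toℕ x + suc l → c ≤ l
    too-far {i} {j} {k} {l} i<j eq eq′ = ≤-trans (m≤n+m c k) (s≤s⁻¹ (+-cancelˡ-≤ (toℕ x) _ _ (begin
      toℕ x + suc (k + c)     ≡⟨ shift (toℕ x) k c ⟩
      (toℕ x + suc k) + c     ≡⟨ cong (_+ c) eq ⟨
      (c * i + v) + c         ≡⟨ shift′ c i v ⟩
      c * suc i + v           ≤⟨ +-monoˡ-≤ v (*-monoʳ-≤ c i<j) ⟩
      c * j + v               ≡⟨ eq′ ⟩
      toℕ x + suc l           ∎)))
      where
      open ≤-Reasoning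
      shift : ∀ x k c → x + suc (k + c) ≡ (x + suc k) + c
      shift = solve-∀
      shift′ : ∀ c i v → (c * i + v) + c ≡ c * suc i + v
      shift′ = solve-∀

    small : ∀ (m : Fin u) → ¬ c ≤ toℕ m
    small m c≤m = <⇒≱ (m<u⇒m<t m) (≤-trans t≤c c≤m)

    periods : _ → toℕ m ≡ toℕ m′
    periods (tri< σ<σ′ _ _) = contradiction (too-far σ<σ′ p p′) (small m′)
    periods (tri> _ _ σ′<σ) = contradiction (too-far σ′<σ p′ p) (small m)
    periods (tri≈ _ σ≡σ′ _) = ℕ.suc-injective (+-cancelˡ-≡ (toℕ x) _ _
      (trans (sym p) (trans (cong (λ i → c * i + v) σ≡σ′) p′)))

  neighbours : Bridge → List Spine
  neighbours (x , γ , τ) = map (λ α → inj₁ (γ , α)) (allFin t) ++ map (λ m → inj₂ (proj₂ (crossed x m))) (allFin u)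

  unique-neighbours : ∀ b → Unique (neighbours b)
  unique-neighbours (x , γ , τ) = Unique.++⁺
    (Unique.map⁺ (λ { refl → refl }) (Unique.allFin⁺ t))
    (Unique.map⁺ (λ eq → crossed-injective x (inj₂-injective eq)) (Unique.allFin⁺ u))
    disjoint
    where
    disjoint : ∀ {i} → ¬ (i ∈ map (λ α → inj₁ (γ , α)) (allFin t) × i ∈ map (λ m → inj₂ (proj₂ (crossed x m))) (allFin u))
    disjoint (i∈ , i∈′) with ∈-map⁻ (λ α → inj₁ (γ , α)) i∈ | ∈-map⁻ (λ m → inj₂ (proj₂ (crossed x m))) i∈′
    ... | _ , _ , refl | _ , _ , ()

  length-neighbours : ∀ b → length (neighbours b) ≡ suc (n + u)
  length-neighbours (x , γ , τ) = trans (length-++ (map (λ α → inj₁ (γ , α)) (allFin t)))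
    (cong₂ _+_ (trans (length-map (λ α → inj₁ (γ , α)) (allFin t)) (length-tabulate {n = t} id))
               (trans (length-map (λ m → inj₂ (proj₂ (crossed x m))) (allFin u)) (length-tabulate {n = u} id)))

  meets : ∀ b {i} → i ∈ neighbours b → ShareEdge (spine i) (bridge b)
  meets (x , γ , τ) i∈ with ∈-++⁻ (map (λ α → inj₁ (γ , α)) (allFin t)) i∈
  ... | inj₁ i∈₁ with ∈-map⁻ (λ α → inj₁ (γ , α)) i∈₁
  ...   | α , _ , refl = meets-across x γ τ α
  meets (x , γ , τ) i∈ | inj₂ i∈₂ with ∈-map⁻ (λ m → inj₂ (proj₂ (crossed x m))) i∈₂
  ...   | m , _ , refl = meets-along x γ τ m

  allAcross : List Across
  allAcross = cartesianProduct (allFin g) (allFin t)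

  spines : List Spine
  spines = map inj₁ allAcross ++ map inj₂ (allFin c)

  bridges : List Bridge
  bridges = cartesianProduct (allFin (t * c′)) allAcross

  withinBlock : Fin g × (Fin t × Fin t) → Spine × Spine
  withinBlock (γ , α , α′) = inj₁ (γ , α) , inj₁ (γ , α′)

  across² across-along along-across along² cooccurring : List (Spine × Spine)
  across²      = map withinBlock (cartesianProduct (allFin g) (cartesianProduct (allFin t) (allFin t)))
  across-along = map (λ (h , v) → inj₁ h , inj₂ v) (cartesianProduct allAcross (allFin c))
  along-across = map (λ (v , h) → inj₂ v , inj₁ h) (cartesianProduct (allFin c) allAcross)
  along²       = map (λ (v , v′) → inj₂ v , inj₂ v′) (cartesianProduct (allFin c) (allFin c))
  cooccurring  = across² ++ (across-along ++ (along-across ++ along²))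

  ∈-allAcross : ∀ h → h ∈ allAcross
  ∈-allAcross (γ , α) = ∈-cartesianProduct⁺ (∈-allFin γ) (∈-allFin α)

  ∈-spines : ∀ i → i ∈ spines
  ∈-spines (inj₁ h) = ∈-++⁺ˡ (∈-map⁺ inj₁ (∈-allAcross h))
  ∈-spines (inj₂ v) = ∈-++⁺ʳ (map inj₁ allAcross) (∈-map⁺ inj₂ (∈-allFin v))

  ∈-cooccurring : ∀ j {i i′} → ShareEdge (spine i) (bridge j) → ShareEdge (spine i′) (bridge j) →
    (i , i′) ∈ cooccurring
  ∈-cooccurring (x , γ , τ) {inj₁ (γ₁ , α₁)} {inj₁ (γ₂ , α₂)} s₁ s₂
    with across-block {α = α₁} {x} {τ = τ} s₁ | across-block {α = α₂} {x} {τ = τ} s₂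
  ... | refl | refl = ∈-++⁺ˡ (∈-map⁺ withinBlock
    (∈-cartesianProduct⁺ (∈-allFin γ) (∈-cartesianProduct⁺ (∈-allFin α₁) (∈-allFin α₂))))
  ∈-cooccurring _ {inj₁ h} {inj₂ v} _ _ = ∈-++⁺ʳ across² (∈-++⁺ˡ
    (∈-map⁺ _ (∈-cartesianProduct⁺ (∈-allAcross h) (∈-allFin v))))
  ∈-cooccurring _ {inj₂ v} {inj₁ h} _ _ = ∈-++⁺ʳ across² (∈-++⁺ʳ across-along (∈-++⁺ˡ
    (∈-map⁺ _ (∈-cartesianProduct⁺ (∈-allFin v) (∈-allAcross h)))))
  ∈-cooccurring _ {inj₂ v} {inj₂ v′} _ _ = ∈-++⁺ʳ across² (∈-++⁺ʳ across-along (∈-++⁺ʳ along-across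
    (∈-map⁺ _ (∈-cartesianProduct⁺ (∈-allFin v) (∈-allFin v′)))))

  length-allFin : ∀ m → length (allFin m) ≡ m
  length-allFin m = length-tabulate {n = m} id

  length-allAcross : length allAcross ≡ a
  length-allAcross = trans (length-cartesianProduct (allFin g) (allFin t)) (cong₂ _*_ (length-allFin g) (length-allFin t))

  length-spines : length spines ≡ a + c
  length-spines = trans (length-++ (map inj₁ allAcross)) (cong₂ _+_
    (trans (length-map inj₁ allAcross) length-allAcross)
    (trans (length-map inj₂ (allFin c)) (length-allFin c)))

  length-bridges : length bridges ≡ t * c′ * a
  length-bridges = trans (length-cartesianProduct (allFin (t * c′)) allAcross)
    (cong₂ _*_ (length-allFin (t * c′)) length-allAcross)

  length-cooccurring : length cooccurring ≡ g * (t * t) + (a * c + (c * a + c * c))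
  length-cooccurring =
    trans (length-++ across²) (cong₂ _+_
      (product withinBlock (allFin g) (cartesianProduct (allFin t) (allFin t)) (length-allFin g)
        (trans (length-cartesianProduct (allFin t) (allFin t)) (cong₂ _*_ (length-allFin t) (length-allFin t))))
    (trans (length-++ across-along) (cong₂ _+_
      (product _ allAcross (allFin c) length-allAcross (length-allFin c))
    (trans (length-++ along-across) (cong₂ _+_
      (product _ (allFin c) allAcross (length-allFin c) length-allAcross)
      (product _ (allFin c) (allFin c) (length-allFin c) (length-allFin c)))))))
    where
    product : ∀ {X Y Z : Set} (f : X × Y → Z) (xs : List X) (ys : List Y) {m n} →
      length xs ≡ m → length ys ≡ n → length (map f (cartesianProduct xs ys)) ≡ m * n
    product f xs ys eq eq′ = trans (length-map f (cartesianProduct xs ys))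
      (trans (length-cartesianProduct xs ys) (cong₂ _*_ eq eq′))

  unique-bridges : Unique bridges
  unique-bridges = Unique.cartesianProduct⁺ (Unique.allFin⁺ (t * c′))
    (Unique.cartesianProduct⁺ (Unique.allFin⁺ g) (Unique.allFin⁺ t))

  bends-spine : ∀ i → bends (spine i) ≤ n + u
  bends-spine (inj₁ (γ , α)) = ≤-trans
    (≤-reflexive (snake-bends (toℕ (combine γ α)) (≤-trans 0<c (≤-trans (m≤m+n c (n * c)) (m≤n+m (t * c) a))) 0<t n true))
    (+-monoʳ-≤ n n≤u)
  bends-spine (inj₂ v) = ≤-trans
    (≤-reflexive (trans (directionChanges-flip (Snake.snake (toℕ v) (c + a * t) c n true))
      (snake-bends (toℕ v) (≤-trans 0<c (m≤m+n c (a * t))) 0<c n true)))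
    (+-monoʳ-≤ n n≤u)

  paths : Spine ⊎ Bridge → GridPath
  paths (inj₁ i) = spine i
  paths (inj₂ j) = bridge j

  numbering : Fin ((g * t + c) + (t * c′) * (g * t)) ↔ (Spine ⊎ Bridge)
  numbering = ↔-trans +↔⊎ (↔-trans +↔⊎ (*↔× ⊎-↔ ↔-refl) ⊎-↔ ↔-trans *↔× (↔-refl ×-↔ *↔×))

  open IntersectionGraph numbering paths public

  graph∈Bₖ : B (n + u) graph
  graph∈Bₖ = graph∈B λ where
    (inj₁ i) → bends-spine i
    (inj₂ j) → ≤-reflexive (zigzag-bends (n + u))

  monotonic-count : ∀ {ℓ} → Bᵐ ℓ graph →
    t * c′ * a * (n + u + (n + u)) ≤
    t * c′ * a * ℓ + ((a + c) + (a + c) + (g * (t * t) + (a * c + (c * a + c * c)))) * suc ℓ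
  monotonic-count {ℓ} (R , monotonic) =
    subst₂ _≤_ (cong (_* (n + u + (n + u))) length-bridges)
      (cong₂ (λ b q → b * ℓ + q * suc ℓ) length-bridges
        (cong₂ _+_ (cong₂ _+_ length-spines length-spines) length-cooccurring))
      (counting cooccurring
        (λ j {i} {i′} s₁ s₂ → ∈-cooccurring j
          (share⁻ {inj₁ i} {inj₂ j} (λ ()) s₁) (share⁻ {inj₁ i′} {inj₂ j} (λ ()) s₂))
        (n + u) neighbours unique-neighbours length-neighbours
        (λ j {i} i∈ → share⁺ {inj₁ i} {inj₂ j} (λ ()) (meets j i∈)))
    where
    open Representation R
    open MonotoneBound (≡-decˢ (≡-dec× Fin._≟_ Fin._≟_) Fin._≟_) spines bridges (Q ∘ inj₁) (Q ∘ inj₂) ℓ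
      (λ i → proj₁ (monotonic _)) (λ j → proj₁ (monotonic _))
      (λ i → proj₂ (monotonic _)) (λ j → proj₂ (monotonic _))
      ∈-spines unique-bridges
      (λ e∈ e∈′ → inj₁-injective (disjoint (λ f∈ f∈′ → cong inj₁ (disjointSpine f∈ f∈′)) e∈ e∈′))
      (λ e∈ e∈′ → inj₂-injective (disjoint (λ f∈ f∈′ → cong inj₂ (disjointBridge f∈ f∈′)) e∈ e∈′))

  graph∉Bᵐ : ∀ {ℓ m} → ℓ + 8 ≤ n + u + (n + u) → suc ℓ ≤ m →
    ((a + c) + (a + c) + (g * (t * t) + (a * c + (c * a + c * c)))) * m < t * c′ * a * 8 →
    ¬ Bᵐ ℓ graph
  graph∉Bᵐ ℓ+8≤ ℓ<m margin member =
    count-contradiction {t * c′ * a} {(a + c) + (a + c) + (g * (t * t) + (a * c + (c * a + c * c)))}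
      ℓ+8≤ ℓ<m margin (monotonic-count member)

-- Choice of the parameters

-- The factor `3 + 4 * w` is `4 * t - 9`. The mixed pairs give about `2 * a * c * (4 * t - 9)`,
-- which falls short of `8 * t * t * t * a` by about `18 * t * t * a`; pairs within blocks and pairs
-- of along paths use up only about `4 * t * t * a` and `t * t * a` of this. The remainder is
-- written with a leading 1 to show that it is positive.
count-margin : ∀ w → let t = 3 + w; c = 1 + t * t; a = 4 * c * t in
  t * (t * t) * a * 8 ≡
  ((a + c) + (a + c) + (4 * c * (t * t) + (a * c + (c * a + c * c)))) * (3 + 4 * w) +
    (1 + (t * t * (t * t * (137 + 52 * w) + 132 * t + 27) + (t * t * (137 + 52 * w) + 132 * t + 26)))
count-margin = solve-∀

-- The equations are hypotheses so that the parameters stay variables in the inequality; they are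
-- substituted only inside `count`.
margin : ∀ {t c′ c g a} w → t ≡ 3 + w → c′ ≡ t * t → c ≡ 1 + c′ → g ≡ 4 * c → a ≡ g * t →
  ((a + c) + (a + c) + (g * (t * t) + (a * c + (c * a + c * c)))) * (3 + 4 * w) < t * c′ * a * 8
margin {t} {c′} {c} {g} {a} w t≡ c′≡ c≡ g≡ a≡ =
  subst (Q * (3 + 4 * w) <_) (sym (count t≡ c′≡ c≡ g≡ a≡)) (m<m+n (Q * (3 + 4 * w)) (s≤s z≤n))
  where
  Q = (a + c) + (a + c) + (g * (t * t) + (a * c + (c * a + c * c)))

  count : ∀ {t c′ c g a} → t ≡ 3 + w → c′ ≡ t * t → c ≡ 1 + c′ → g ≡ 4 * c → a ≡ g * t → t * c′ * a * 8 ≡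
    ((a + c) + (a + c) + (g * (t * t) + (a * c + (c * a + c * c)))) * (3 + 4 * w) +
    (1 + (t * t * (t * t * (137 + 52 * w) + 132 * t + 27) + (t * t * (137 + 52 * w) + 132 * t + 26)))
  count refl refl refl refl refl = count-margin w

separationₙ : ∀ {n u c′ g} w → n ≡ 2 + w → c′ ≡ suc n * suc n → g ≡ 4 * suc c′ → n ≤ u → u ≤ suc n →
  ∃[ G ] (B (n + u) G × (∀ ℓ → ℓ + 8 ≤ n + u + (n + u) → ¬ Bᵐ ℓ G))
separationₙ {n} {u} {c′} {g} w n≡ c′≡ g≡ n≤u u≤t =
  graph , graph∈Bₖ , λ ℓ ℓ+8≤ → graph∉Bᵐ ℓ+8≤ (bound ℓ ℓ+8≤) (margin w (cong suc n≡) c′≡ refl g≡ refl)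
  where
  open Construction n u c′ g (subst (0 <_) (sym n≡) (s≤s z≤n)) n≤u u≤t
    (m≤n⇒m≤1+n (subst (suc n ≤_) (sym c′≡) (m≤m+n (suc n) (n * suc n))))

  -- From `u ≤ n + 1` and `n = 2 + w` follows `ℓ + 8 ≤ 4 * n + 2 = 4 * w + 10`, that is,
  -- `ℓ + 1 ≤ 4 * w + 3`.
  bound : ∀ ℓ → ℓ + 8 ≤ n + u + (n + u) → suc ℓ ≤ 3 + 4 * w
  bound ℓ ℓ+8≤ = +-cancelʳ-≤ 7 _ _ (≤-trans (≤-reflexive (sym (+-suc ℓ 7))) (≤-trans ℓ+8≤ (≤-trans
    (+-mono-≤ (+-monoʳ-≤ n u≤t) (+-monoʳ-≤ n u≤t)) (≤-reflexive (total n≡)))))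
    where
    total′ : ∀ w → 2 + w + (3 + w) + (2 + w + (3 + w)) ≡ 3 + 4 * w + 7
    total′ = solve-∀
    total : ∀ {n} → n ≡ 2 + w → n + suc n + (n + suc n) ≡ 3 + 4 * w + 7
    total refl = total′ w

-- Excluding every `ℓ` up to the bound, for one and the same graph, allows evaluation at both
-- `2 * k ∸ 8` and `2 * k ∸ 9`.
separation : ∀ k → 5 ≤ k → ∃[ G ] (B k G × (∀ ℓ → ℓ ≤ 2 * k ∸ 8 → ¬ Bᵐ ℓ G))
separation k 5≤k = restate (subst (λ k → ∃[ G ] (B k G × (∀ ℓ → ℓ + 8 ≤ k + k → ¬ Bᵐ ℓ G))) (⌊n/2⌋+⌈n/2⌉≡n k)
  -- With `n` and `u` the two halves of `k`, rounded down and up, `5 ≤ k` gives `2 ≤ n`, so the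
  -- subtraction defining `w` is exact.
  (separationₙ (⌊ k /2⌋ ∸ 2) (sym (m+[n∸m]≡n (⌊n/2⌋-mono 5≤k))) refl refl (⌊n/2⌋≤⌈n/2⌉ k) (⌈n/2⌉≤1+⌊n/2⌋ k)))
  where
  ⌈n/2⌉≤1+⌊n/2⌋ : ∀ n → ⌈ n /2⌉ ≤ suc ⌊ n /2⌋
  ⌈n/2⌉≤1+⌊n/2⌋ zero          = z≤n
  ⌈n/2⌉≤1+⌊n/2⌋ (suc zero)    = s≤s z≤n
  ⌈n/2⌉≤1+⌊n/2⌋ (suc (suc n)) = s≤s (⌈n/2⌉≤1+⌊n/2⌋ n)

  -- This makes `2 * k ∸ 8` an exact difference, so that adding 8 gives `2 * k` again.
  8≤2k : 8 ≤ 2 * k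
  8≤2k = ≤-trans (m≤m+n 8 2) (*-monoʳ-≤ 2 5≤k)

  restate : ∃[ G ] (B k G × (∀ ℓ → ℓ + 8 ≤ k + k → ¬ Bᵐ ℓ G)) →
            ∃[ G ] (B k G × (∀ ℓ → ℓ ≤ 2 * k ∸ 8 → ¬ Bᵐ ℓ G))
  restate (G , G∈B , G∉Bᵐ) = G , G∈B , λ ℓ ℓ≤ → G∉Bᵐ ℓ (≤-trans (+-monoˡ-≤ 8 ℓ≤)
    (≤-reflexive (trans (m∸n+n≡m 8≤2k) (cong (λ m → k + m) (+-identityʳ k)))))

theorem4p1 : (k : ℕ) → 5 ≤ k →
    (¬ (2 ∣ k) → ∃[ G ] (B k G × ¬ Bᵐ (2 * k ∸ 8) G)) ×
    (2 ∣ k → ∃[ G ] (B k G × ¬ Bᵐ (2 * k ∸ 9) G))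
theorem4p1 k 5≤k = at-2k∸8 (separation k 5≤k) , at-2k∸9 (separation k 5≤k)
  where
  Separated = ∃[ G ] (B k G × (∀ ℓ → ℓ ≤ 2 * k ∸ 8 → ¬ Bᵐ ℓ G))

  at-2k∸8 : Separated → ¬ (2 ∣ k) → ∃[ G ] (B k G × ¬ Bᵐ (2 * k ∸ 8) G)
  at-2k∸8 (G , G∈B , G∉Bᵐ) _ = G , G∈B , G∉Bᵐ (2 * k ∸ 8) ≤-refl

  at-2k∸9 : Separated → 2 ∣ k → ∃[ G ] (B k G × ¬ Bᵐ (2 * k ∸ 9) G)
  at-2k∸9 (G , G∈B , G∉Bᵐ) _ = G , G∈B , G∉Bᵐ (2 * k ∸ 9) (∸-monoʳ-≤ (2 * k) (n≤1+n 8))
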